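{- The numbers $E_m(n)$ and $E_{\geq m}(n)$ defined in the context satisfy, for all integers $0\leq m<n$, the recurrence $$E_m(n)=\sum_{j=1}^m\sum_{i=1}^{n-m-1}\binom{n-m-1}{i-1}E_{\geq j}(i+j-1)\,E_{\geq m-j}(n-j-i),$$ with initial conditions $E_1(1)=1$ and $E_n(n)=0$ for all integers $n\ge 2$.
   Context: $S_n$ is the set of permutations of $\{1,\ldots,n\}$, written as words $\pi=\pi_1\cdots\pi_n$. The (West) stack-sorting map $s:S_n\to S_n$ is defined by the following procedure on an input $\pi=\pi_1\cdots\pi_n$, using an initially empty vertical stack. At any point in time, if there is a next entry of the input and either it is smaller than the entry at the top of the stack or the stack is empty, then that next entry is placed on top of the stack. Otherwise, the entry at the top of the stack is removed and appended to the end of the output. The procedure terminates when the output has length $n$, and $s(\pi)$ is this output. A permutation $\pi\in S_n$ is uniquely sorted if $|s^{ -1}(\pi)|=1$. The tail length $\mathrm{tl}(\pi)$ of $\pi\in S_n$ is the smallest nonnegative integer $i$ such that $\pi_{n-i}\neq n-i$, where the identity permutation of $S_n$ is understood to have tail length $n$. $E_m(n)$ is the number of uniquely sorted permutations in $S_n$ with tail length $m$, and $E_{\geq m}(n)=\sum_{\ell=m}^nE_\ell(n)$. Empty sums equal $0$. -}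

module Defs where

open import Data.Bool using (if_then_else_)
open import Data.List using (List; []; _∷_; applyUpTo; cartesianProductWith; filter; length; map; takeWhile; upTo)
open import Data.List.Properties using (≡-dec)
open import Data.Nat using (ℕ; zero; suc; _+_; _∸_; _≟_; _<?_)
open import Data.List.Relation.Unary.Unique.DecPropositional _≟_ using (unique?)
open import Data.Nat.ListAction using (sum)
open import Data.Product using (_×_)
open import Relation.Binary.PropositionalEquality using (_≡_)
open import Relation.Nullary using (Dec; does)
open import Relation.Nullary.Decidable using (_×-dec_)

-- The integers a, a + 1, …, b in increasing order; empty when b < a.
[_⋯_] : ℕ → ℕ → List ℕ
[ a ⋯ b ] = applyUpTo (a +_) (suc b ∸ a)

∑ : ℕ → ℕ → (ℕ → ℕ) → ℕ
∑ a b f = sum (map f [ a ⋯ b ])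

syntax ∑ a b (λ i → t) = ∑[ i from a to b ] t

words : ℕ → List ℕ → List (List ℕ)
words zero    A = [] ∷ []
words (suc k) A = cartesianProductWith _∷_ A (words k A)

-- Permutations of {1, …, n} are the words of length n over {1, …, n} without
-- repeated letters.  Each one is listed exactly once, so cardinalities of
-- decidable subsets of S n are lengths of filtered lists.
S : ℕ → List (List ℕ)
S n = filter unique? (words n [ 1 ⋯ n ])

-- The output still to be produced from the given remaining input and the given
-- stack (top of the stack first).  The procedure stops when both are empty,
-- that is, when all letters have been output.
run : (input stack : List ℕ) → List ℕ
run []      []      = []
run []      (t ∷ σ) = t ∷ run [] σ
run (x ∷ ι) []      = run ι (x ∷ [])
run (x ∷ ι) (t ∷ σ) =
  if does (x <? t) then run ι (x ∷ t ∷ σ) else t ∷ run (x ∷ ι) σ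

s : List ℕ → List ℕ
s π = run π []

preimage : ℕ → List ℕ → List (List ℕ)
preimage n π = filter (λ σ → ≡-dec _≟_ (s σ) π) (S n)

UniquelySorted : ℕ → List ℕ → Set
UniquelySorted n π = length (preimage n π) ≡ 1

-- π ! k is the letter πₖ, for 1 ≤ k ≤ length π.  Outside this range the value
-- is 0, which is never a letter of a permutation.
_!_ : List ℕ → ℕ → ℕ
[]      ! _           = 0
(x ∷ π) ! zero        = 0
(x ∷ π) ! suc zero    = x
(x ∷ π) ! suc (suc k) = π ! suc k

-- The initial run of those i in 0, …, n - 1 with π_{n-i} = n - i has length
-- equal to the least i violating the equation, or n if there is none.
tl : List ℕ → ℕ
tl π = length (takeWhile (λ i → π ! (n ∸ i) ≟ n ∸ i) (upTo n))
  where
  n : ℕ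
  n = length π

counted? : ∀ m n π → Dec (UniquelySorted n π × tl π ≡ m)
counted? m n π = (length (preimage n π) ≟ 1) ×-dec (tl π ≟ m)

E : ℕ → ℕ → ℕ
E m n = length (filter (counted? m n) (S n))

E≥ : ℕ → ℕ → ℕ
E≥ m n = ∑[ ℓ from m to n ] E ℓ n

{-# OPTIONS --safe #-}

-- Preimages of π under s correspond to decreasing binary plane trees with
-- postorder reading π.  Parse π from left to right, keeping a stack of trees.
-- Write π = A y B t₁ ⋯ tₘ with B nonempty, y the largest letter besides the tail
-- t₁ < ⋯ < tₘ.  The trees built from B lie above y, and only the sizes of the
-- stacks matter once the tail is read.  Splitting the tail at the first moment
-- when all trees coming from B have been absorbed gives
--
--   h (A y B) m = Σ_{j=1}^m h A j * h B (m - j),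
--
-- where h w j is the number of preimages of w followed by j larger letters.
-- Both h A j (for j ≥ 1) and h B j at least double when j is increased, so the
-- sum equals 1 exactly when one of its terms does, and that term is then the
-- only one that equals 1.  Summing over all words AB, with a binomial coefficient
-- for the choice of the letters of A, gives the recurrence.
module Submission where

open import Defs
open import Data.Bool using (true; false; if_then_else_)
open import Data.List using (List; []; _∷_; _++_; _∷ʳ_; [_]; map; concatMap; length; upTo; applyUpTo; applyDownFrom; filter; takeWhile; reverse; foldr)
open import Data.List.Membership.Propositional using (_∈_; _∉_)
open import Data.List.Membership.Propositional.Properties
open import Data.List.Membership.Propositional.Properties.WithK using (unique∧set⇒bag)
open import Data.List.Properties hiding (sum-++)
open import Data.List.Relation.Binary.BagAndSetEquality using (∼bag⇒↭)
open import Data.List.Relation.Binary.Permutation.Propositional using (_↭_; prep; ↭-refl; ↭-sym; ↭-trans; ↭⇒↭ₛ)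
import Data.List.Relation.Binary.Permutation.Propositional.Properties as ↭
import Data.List.Relation.Binary.Permutation.Setoid.Properties as ↭ₛ
open import Data.List.Relation.Binary.Pointwise as Pointwise using (Pointwise; []; _∷_)
open import Data.List.Relation.Binary.Subset.Propositional using (_⊆_)
open import Data.List.Relation.Unary.All as All using (All; []; _∷_)
import Data.List.Relation.Unary.All.Properties as All
open import Data.List.Relation.Unary.AllPairs using (AllPairs; []; _∷_)
import Data.List.Relation.Unary.AllPairs.Properties as AllPairs
open import Data.List.Relation.Unary.Any using (here; there)
open import Data.List.Relation.Unary.Unique.Propositional using (Unique)
import Data.List.Relation.Unary.Unique.Propositional.Properties as Unique
open import Data.Nat
open import Data.List.Relation.Unary.Unique.DecPropositional _≟_ using (unique?)
open import Data.Nat.Combinatorics using (_C_; nCk+nC[k+1]≡[n+1]C[k+1])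
open import Data.Nat.Combinatorics.Specification using (k>n⇒nCk≡0)
open import Data.Nat.ListAction using (sum)
open import Data.Nat.ListAction.Properties using (sum-++; sum-↭)
open import Data.Nat.Properties
open import Data.Nat.Tactic.RingSolver using (solve-∀)
open import Data.Product using (∃; _×_; _,_; proj₁; proj₂; map₁)
open import Data.Unit using (⊤; tt)
open import Function using (_∘_; id)
open import Function.Bundles using (mk⇔)
open import Relation.Binary.PropositionalEquality hiding ([_])
open import Relation.Nullary using (Dec; yes; no; does; ¬_; contradiction)
open import Relation.Nullary.Decidable using (dec-true; dec-false)

-- The preimage that belongs to a tree is its inorder reading. Doubling holds because a letter above
-- everything may adopt the topmost tree as its left or as its right only child, which leaves the
-- number of trees unchanged. The empty stack is the exception: there the letter has no choice, and
-- 0 or 1 larger letters both give one way. Hence `j` must be positive for `A`, which may be empty,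
-- while the nonempty `B` needs no such bound. One letter of the tail is spent on joining the last
-- tree above `y` to the tree with root `y`, so only `m - 1` letters are shared out; but for `A` the
-- letter `y` is itself a larger letter, which restores the sum `m`. `A` may end in its own largest
-- letters, so `A` followed by `j` larger letters has tail length at least `j`, not exactly `j`.
-- This is why `E≥` stands on the right although `E` stands on the left, where the nonemptiness of
-- `B` says that the tail length is exactly `m`.

private variable
  X Y : Set

-- Finite sums over lists

Σ[_] : List X → (X → ℕ) → ℕ
Σ[ xs ] f = sum (map f xs)

Σ-cong : ∀ {f g : X → ℕ} → (∀ x → f x ≡ g x) → ∀ xs → Σ[ xs ] f ≡ Σ[ xs ] g
Σ-cong eq xs = cong sum (map-cong eq xs)

Σ-cong-All : ∀ {f g : X → ℕ} {xs} → All (λ x → f x ≡ g x) xs → Σ[ xs ] f ≡ Σ[ xs ] g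
Σ-cong-All eqs = cong sum (map-cong-local eqs)

Σ-cong-Pointwise : ∀ {R : X → Y → Set} {f : X → ℕ} {g : Y → ℕ} → (∀ {x y} → R x y → f x ≡ g y) →
  ∀ {xs ys} → Pointwise R xs ys → Σ[ xs ] f ≡ Σ[ ys ] g
Σ-cong-Pointwise eq []       = refl
Σ-cong-Pointwise eq (r ∷ rs) = cong₂ _+_ (eq r) (Σ-cong-Pointwise eq rs)

Σ-↭ : ∀ {xs ys : List X} (f : X → ℕ) → xs ↭ ys → Σ[ xs ] f ≡ Σ[ ys ] f
Σ-↭ f p = sum-↭ (↭.map⁺ f p)

Σ-++ : ∀ (f : X → ℕ) xs ys → Σ[ xs ++ ys ] f ≡ Σ[ xs ] f + Σ[ ys ] f
Σ-++ f xs ys = trans (cong sum (map-++ f xs ys)) (sum-++ (map f xs) (map f ys))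

Σ-map : ∀ (g : X → Y) (f : Y → ℕ) xs → Σ[ map g xs ] f ≡ Σ[ xs ] (f ∘ g)
Σ-map g f xs = cong sum (sym (map-∘ xs))

Σ-concatMap : ∀ (g : X → List Y) (f : Y → ℕ) xs →
  Σ[ concatMap g xs ] f ≡ Σ[ xs ] (λ x → Σ[ g x ] f)
Σ-concatMap g f []       = refl
Σ-concatMap g f (x ∷ xs) =
  trans (Σ-++ f (g x) (concatMap g xs)) (cong (Σ[ g x ] f +_) (Σ-concatMap g f xs))

Σ-0 : ∀ (xs : List X) → Σ[ xs ] (λ _ → 0) ≡ 0
Σ-0 []       = refl
Σ-0 (x ∷ xs) = Σ-0 xs

+-interchange : ∀ a b c d → (a + b) + (c + d) ≡ (a + c) + (b + d)
+-interchange = solve-∀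

Σ-+ : ∀ (f g : X → ℕ) xs → Σ[ xs ] (λ x → f x + g x) ≡ Σ[ xs ] f + Σ[ xs ] g
Σ-+ f g []       = refl
Σ-+ f g (x ∷ xs) =
  trans (cong (f x + g x +_) (Σ-+ f g xs)) (+-interchange (f x) (g x) (Σ[ xs ] f) (Σ[ xs ] g))

Σ-*ˡ : ∀ k (f : X → ℕ) xs → Σ[ xs ] (λ x → k * f x) ≡ k * Σ[ xs ] f
Σ-*ˡ k f []       = sym (*-zeroʳ k)
Σ-*ˡ k f (x ∷ xs) = trans (cong (k * f x +_) (Σ-*ˡ k f xs)) (sym (*-distribˡ-+ k (f x) _))

Σ-*ʳ : ∀ k (f : X → ℕ) xs → Σ[ xs ] (λ x → f x * k) ≡ Σ[ xs ] f * k
Σ-*ʳ k f []       = refl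
Σ-*ʳ k f (x ∷ xs) = trans (cong (f x * k +_) (Σ-*ʳ k f xs)) (sym (*-distribʳ-+ k (f x) _))

Σ-swap : ∀ (f : X → Y → ℕ) xs ys →
  Σ[ xs ] (λ x → Σ[ ys ] (f x)) ≡ Σ[ ys ] (λ y → Σ[ xs ] (λ x → f x y))
Σ-swap f []       ys = sym (Σ-0 ys)
Σ-swap f (x ∷ xs) ys =
  trans (cong (Σ[ ys ] (f x) +_) (Σ-swap f xs ys)) (sym (Σ-+ (f x) _ ys))

Σ-product : ∀ (f : X → ℕ) (g : Y → ℕ) xs ys →
  Σ[ xs ] (λ x → Σ[ ys ] (λ y → f x * g y)) ≡ Σ[ xs ] f * Σ[ ys ] g
Σ-product f g xs ys =
  trans (Σ-cong (λ x → Σ-*ˡ (f x) g ys) xs) (Σ-*ʳ (Σ[ ys ] g) f xs)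

Σ-applyUpTo-cong : ∀ {f g : ℕ → X} {F G : X → ℕ} n → (∀ {i} → i < n → F (f i) ≡ G (g i)) →
  Σ[ applyUpTo f n ] F ≡ Σ[ applyUpTo g n ] G
Σ-applyUpTo-cong zero    eq = refl
Σ-applyUpTo-cong (suc n) eq = cong₂ _+_ (eq z<s) (Σ-applyUpTo-cong n (eq ∘ s<s))

Σ-upTo-last : ∀ (F : ℕ → ℕ) n → Σ[ upTo (suc n) ] F ≡ Σ[ upTo n ] F + F n
Σ-upTo-last F n = begin
  Σ[ upTo (suc n) ] F        ≡⟨ cong (λ l → Σ[ l ] F) (upTo-∷ʳ n) ⟨
  Σ[ upTo n ++ n ∷ [] ] F    ≡⟨ Σ-++ F (upTo n) (n ∷ []) ⟩
  Σ[ upTo n ] F + (F n + 0)  ≡⟨ cong (Σ[ upTo n ] F +_) (+-identityʳ (F n)) ⟩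
  Σ[ upTo n ] F + F n        ∎
  where open ≡-Reasoning

-- Indicators, convolutions and doubling sequences

δ : ℕ → ℕ → ℕ
δ zero    zero    = 1
δ zero    (suc _) = 0
δ (suc _) zero    = 0
δ (suc a) (suc b) = δ a b

δ-refl : ∀ a → δ a a ≡ 1
δ-refl zero    = refl
δ-refl (suc a) = δ-refl a

δ-≢ : ∀ {a b} → a ≢ b → δ a b ≡ 0
δ-≢ {zero}  {zero}  ne = contradiction refl ne
δ-≢ {zero}  {suc b} ne = refl
δ-≢ {suc a} {zero}  ne = refl
δ-≢ {suc a} {suc b} ne = δ-≢ (ne ∘ cong suc)

Σ-δ : ∀ {a} n → a < n → Σ[ upTo n ] (δ a) ≡ 1
Σ-δ {a} (suc n) a<1+n with a ≟ n
... | yes refl = begin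
  Σ[ upTo (suc a) ] (δ a)      ≡⟨ Σ-upTo-last (δ a) a ⟩
  Σ[ upTo a ] (δ a) + δ a a
    ≡⟨ cong₂ _+_ (Σ-applyUpTo-cong {g = id} {G = λ _ → 0} a (λ i<a → δ-≢ (>⇒≢ i<a))) (δ-refl a) ⟩
  Σ[ upTo a ] (λ _ → 0) + 1    ≡⟨ cong (_+ 1) (Σ-0 (upTo a)) ⟩
  1                            ∎
  where open ≡-Reasoning
... | no a≢n = trans (Σ-upTo-last (δ a) n)
                 (cong₂ _+_ (Σ-δ n (≤∧≢⇒< (s≤s⁻¹ a<1+n) a≢n)) (δ-≢ a≢n))

length-filter-Σ : ∀ {P : X → Set} (P? : ∀ x → Dec (P x)) (ι : X → ℕ) →
  (∀ x → P x → ι x ≡ 1) → (∀ x → ¬ P x → ι x ≡ 0) →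
  ∀ xs → length (filter P? xs) ≡ Σ[ xs ] ι
length-filter-Σ P? ι one zer [] = refl
length-filter-Σ P? ι one zer (x ∷ xs) with P? x
... | yes p = cong₂ _+_ (sym (one x p)) (length-filter-Σ P? ι one zer xs)
... | no ¬p = cong₂ _+_ (sym (zer x ¬p)) (length-filter-Σ P? ι one zer xs)

-- The two indices add up to `m - 1`, because one of `m` tail letters performs the join between the
-- two groups of trees.
conv : (ℕ → ℕ) → (ℕ → ℕ) → ℕ → ℕ
conv a b zero    = 0
conv a b (suc m) = a 0 * b m + conv (a ∘ suc) b m

conv-congˡ : ∀ {a a′} b m → (∀ j → a j ≡ a′ j) → conv a b m ≡ conv a′ b m
conv-congˡ b zero    eq = refl
conv-congˡ b (suc m) eq = cong₂ _+_ (cong (_* b m) (eq 0)) (conv-congˡ b m (eq ∘ suc))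

conv-0ˡ : ∀ b m → conv (λ _ → 0) b m ≡ 0
conv-0ˡ b zero    = refl
conv-0ˡ b (suc m) = conv-0ˡ b m

conv-+ˡ : ∀ a a′ b m → conv (λ j → a j + a′ j) b m ≡ conv a b m + conv a′ b m
conv-+ˡ a a′ b zero    = refl
conv-+ˡ a a′ b (suc m) = trans
  (cong₂ _+_ (*-distribʳ-+ (b m) (a 0) (a′ 0)) (conv-+ˡ (a ∘ suc) (a′ ∘ suc) b m))
  (+-interchange (a 0 * b m) (a′ 0 * b m) _ _)

conv-*ˡ : ∀ k a b m → conv (λ j → k * a j) b m ≡ k * conv a b m
conv-*ˡ k a b zero    = sym (*-zeroʳ k)
conv-*ˡ k a b (suc m) = trans
  (cong₂ _+_ (*-assoc k (a 0) (b m)) (conv-*ˡ k (a ∘ suc) b m))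
  (sym (*-distribˡ-+ k (a 0 * b m) _))

conv-Σ : ∀ (f : X → ℕ → ℕ) (g : Y → ℕ → ℕ) xs ys m →
  Σ[ xs ] (λ x → Σ[ ys ] (λ y → conv (f x) (g y) m)) ≡
  conv (λ j → Σ[ xs ] (λ x → f x j)) (λ j → Σ[ ys ] (λ y → g y j)) m
conv-Σ f g xs ys zero    = trans (Σ-cong (λ _ → Σ-0 ys) xs) (Σ-0 xs)
conv-Σ f g xs ys (suc m) = begin
  Σ[ xs ] (λ x → Σ[ ys ] (λ y → f x 0 * g y m + conv (f x ∘ suc) (g y) m))
    ≡⟨ Σ-cong (λ x → Σ-+ _ _ ys) xs ⟩
  Σ[ xs ] (λ x → Σ[ ys ] (λ y → f x 0 * g y m) + Σ[ ys ] (λ y → conv (f x ∘ suc) (g y) m))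
    ≡⟨ Σ-+ _ _ xs ⟩
  Σ[ xs ] (λ x → Σ[ ys ] (λ y → f x 0 * g y m)) +
  Σ[ xs ] (λ x → Σ[ ys ] (λ y → conv (f x ∘ suc) (g y) m))
    ≡⟨ cong₂ _+_ (Σ-product (λ x → f x 0) (λ y → g y m) xs ys) (conv-Σ (λ x → f x ∘ suc) g xs ys m) ⟩
  _ ∎
  where open ≡-Reasoning

conv-upTo : ∀ a b m → conv a b m ≡ Σ[ upTo m ] (λ j → a j * b (m ∸ suc j))
conv-upTo a b zero    = refl
conv-upTo a b (suc m) = cong (a 0 * b m +_)
  (trans (conv-upTo (a ∘ suc) b m) (Σ-applyUpTo-cong m (λ _ → refl)))

Doubling : (ℕ → ℕ) → Set
Doubling a = ∀ j → 2 * a j ≤ a (suc j)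

doubling-≥2 : ∀ a → Doubling a → 1 ≤ a 0 → ∀ j → 2 ≤ a (suc j)
doubling-≥2 a da 1≤a zero    = ≤-trans (*-monoʳ-≤ 2 1≤a) (da 0)
doubling-≥2 a da 1≤a (suc j) =
  doubling-≥2 (a ∘ suc) (da ∘ suc) (≤-trans (s≤s z≤n) (≤-trans (*-monoʳ-≤ 2 1≤a) (da 0))) j

-- A positive value at `j` would force every later value, in particular `b m`, to be at least 2.
doubling-zero : ∀ b → Doubling b → ∀ m → b m ≡ 1 → ∀ {j} → j < m → b j ≡ 0
doubling-zero b db (suc m) bm≡1 {j} j<1+m = go (b j) refl
  where
  go : ∀ v → b j ≡ v → b j ≡ 0
  go zero    eq = eq
  go (suc v) eq = contradiction bm≡1 (>⇒≢ (subst (2 ≤_) (cong b lemma)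
      (doubling-≥2 (λ i → b (i + j)) (λ i → db (i + j)) (≤-trans (s≤s z≤n) (≤-reflexive (sym eq))) (m ∸ j))))
    where
    lemma : suc (m ∸ j) + j ≡ suc m
    lemma = cong suc (m∸n+n≡m (s≤s⁻¹ j<1+m))

conv-zeroʳ : ∀ a b m → (∀ {j} → j < m → b j ≡ 0) → conv a b m ≡ 0
conv-zeroʳ a b zero    eq = refl
conv-zeroʳ a b (suc m) eq = cong₂ _+_
  (trans (cong (a 0 *_) (eq (n<1+n m))) (*-zeroʳ (a 0))) (conv-zeroʳ (a ∘ suc) b m (eq ∘ m<n⇒m<1+n))

-- Each product is 0 or at least 2, according to whether its factor from `b` vanishes.
conv-≢1 : ∀ a b m → (∀ j → 2 ≤ a j) → conv a b m ≢ 1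
conv-≢1 a b (suc m) 2≤a eq with b m
... | zero  = conv-≢1 (a ∘ suc) b m (2≤a ∘ suc)
                (trans (cong (_+ conv (a ∘ suc) b m) (sym (*-zeroʳ (a 0)))) eq)
... | suc v = <⇒≢ (≤-trans (*-mono-≤ {2} {a 0} {1} (2≤a 0) (s≤s z≤n)) (m≤m+n (a 0 * suc v) _)) (sym eq)

-- Among the products a j * b j′ with j + j′ = m - 1, at most one is nonzero as
-- soon as one of them equals 1.
δ-conv : ∀ a b → Doubling a → Doubling b → ∀ m →
  δ 1 (conv a b m) ≡ conv (δ 1 ∘ a) (δ 1 ∘ b) m
δ-conv a b da db zero = refl
δ-conv a b da db (suc m) = by-first (a 0) refl (b m) refl
  where
  open ≡-Reasoning
  rest : ℕ
  rest = conv (a ∘ suc) b m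
  by-first : ∀ u → a 0 ≡ u → ∀ v → b m ≡ v →
    δ 1 (conv a b (suc m)) ≡ conv (δ 1 ∘ a) (δ 1 ∘ b) (suc m)
  by-first zero eq v _ = begin
    δ 1 (a 0 * b m + rest)       ≡⟨ cong (λ t → δ 1 (t * b m + rest)) eq ⟩
    δ 1 rest                     ≡⟨ δ-conv (a ∘ suc) b (da ∘ suc) db m ⟩
    conv (δ 1 ∘ a ∘ suc) (δ 1 ∘ b) m
      ≡⟨ cong (λ t → δ 1 t * δ 1 (b m) + conv (δ 1 ∘ a ∘ suc) (δ 1 ∘ b) m) eq ⟨
    conv (δ 1 ∘ a) (δ 1 ∘ b) (suc m) ∎
  by-first (suc u) eq v eqv = trans (lhs u v eq eqv) (sym rhs)
    where
    -- As `a 0` is positive, all later values of `a` are at least 2, so on the right only the first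
    -- product can survive. The left side is compared with it according to the value of `b m`.
    2≤a : ∀ j → 2 ≤ a (suc j)
    2≤a = doubling-≥2 a da (≤-trans (s≤s z≤n) (≤-reflexive (sym eq)))
    rhs : conv (δ 1 ∘ a) (δ 1 ∘ b) (suc m) ≡ δ 1 (a 0) * δ 1 (b m)
    rhs = begin
      δ 1 (a 0) * δ 1 (b m) + conv (δ 1 ∘ a ∘ suc) (δ 1 ∘ b) m
        ≡⟨ cong (δ 1 (a 0) * δ 1 (b m) +_) (conv-congˡ (δ 1 ∘ b) m (λ j → δ-≢ (<⇒≢ (2≤a j)))) ⟩
      δ 1 (a 0) * δ 1 (b m) + conv (λ _ → 0) (δ 1 ∘ b) m
        ≡⟨ cong (δ 1 (a 0) * δ 1 (b m) +_) (conv-0ˡ (δ 1 ∘ b) m) ⟩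
      δ 1 (a 0) * δ 1 (b m) + 0
        ≡⟨ +-identityʳ _ ⟩
      δ 1 (a 0) * δ 1 (b m) ∎
    lhs : ∀ u v → a 0 ≡ suc u → b m ≡ v → δ 1 (a 0 * b m + rest) ≡ δ 1 (a 0) * δ 1 (b m)
    lhs u zero eqa eqb = begin
      δ 1 (a 0 * b m + rest)  ≡⟨ cong (λ t → δ 1 (a 0 * t + rest)) eqb ⟩
      δ 1 (a 0 * 0 + rest)    ≡⟨ cong (λ t → δ 1 (t + rest)) (*-zeroʳ (a 0)) ⟩
      δ 1 rest                ≡⟨ δ-≢ (conv-≢1 (a ∘ suc) b m 2≤a ∘ sym) ⟩
      0                       ≡⟨ *-zeroʳ (δ 1 (a 0)) ⟨
      δ 1 (a 0) * 0           ≡⟨ cong (λ t → δ 1 (a 0) * δ 1 t) eqb ⟨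
      δ 1 (a 0) * δ 1 (b m)   ∎
    -- Here `b m` is 1, so all earlier values of `b` vanish and `rest` is 0.
    lhs u (suc zero) eqa eqb = begin
      δ 1 (a 0 * b m + rest)  ≡⟨ cong (λ t → δ 1 (a 0 * b m + t)) (conv-zeroʳ (a ∘ suc) b m (doubling-zero b db m eqb)) ⟩
      δ 1 (a 0 * b m + 0)     ≡⟨ cong (λ t → δ 1 (a 0 * t + 0)) eqb ⟩
      δ 1 (a 0 * 1 + 0)       ≡⟨ cong (δ 1) (trans (+-identityʳ (a 0 * 1)) (*-identityʳ (a 0))) ⟩
      δ 1 (a 0)               ≡⟨ *-identityʳ (δ 1 (a 0)) ⟨
      δ 1 (a 0) * 1           ≡⟨ cong (λ t → δ 1 (a 0) * δ 1 t) eqb ⟨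
      δ 1 (a 0) * δ 1 (b m)   ∎
    lhs u (suc (suc v)) eqa eqb = begin
      δ 1 (a 0 * b m + rest)  ≡⟨ δ-≢ (<⇒≢ 2≤sum) ⟩
      0                       ≡⟨ *-zeroʳ (δ 1 (a 0)) ⟨
      δ 1 (a 0) * 0           ≡⟨ cong (λ t → δ 1 (a 0) * δ 1 t) eqb ⟨
      δ 1 (a 0) * δ 1 (b m)   ∎
      where
      2≤sum : 2 ≤ a 0 * b m + rest
      2≤sum = ≤-trans (*-mono-≤ {1} {a 0} {2} (≤-trans (s≤s z≤n) (≤-reflexive (sym eqa)))
                (≤-trans (s≤s (s≤s z≤n)) (≤-reflexive (sym eqb)))) (m≤m+n (a 0 * b m) rest)

-- Parsing a word as the postorder of a decreasing binary plane tree

Σ-mono-All : ∀ {f g : X → ℕ} {xs} → All (λ x → f x ≤ g x) xs → Σ[ xs ] f ≤ Σ[ xs ] g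
Σ-mono-All []       = z≤n
Σ-mono-All (p ∷ ps) = +-mono-≤ p (Σ-mono-All ps)

All-concatMap : ∀ {P : Y → Set} {g : X → List Y} {xs} → All (All P ∘ g) xs → All P (concatMap g xs)
All-concatMap []         = []
All-concatMap (ps ∷ pss) = All.++⁺ ps (All-concatMap pss)

-- Read in postorder, a letter x becomes the root of a new tree whose (possibly
-- empty) subtrees are the most recent trees with smaller roots; the stack records
-- the roots only.  The duplicate entry of steps accounts for a left or right only
-- child.
joinTwo : ℕ → List ℕ → List (List ℕ)
joinTwo x []      = []
joinTwo x (u ∷ σ) = if does (u <? x) then (x ∷ σ) ∷ [] else []

steps : ℕ → List ℕ → List (List ℕ)
steps x []      = (x ∷ []) ∷ []
steps x (t ∷ σ) =
  (x ∷ t ∷ σ) ∷ (if does (t <? x) then (x ∷ σ) ∷ (x ∷ σ) ∷ joinTwo x σ else [])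

ends : List ℕ → List ℕ → List (List ℕ)
ends σ []      = σ ∷ []
ends σ (x ∷ w) = concatMap (λ τ → ends τ w) (steps x σ)

Σ-ends-++ : ∀ f σ v w → Σ[ ends σ (v ++ w) ] f ≡ Σ[ ends σ v ] (λ τ → Σ[ ends τ w ] f)
Σ-ends-++ f σ []      w = sym (+-identityʳ _)
Σ-ends-++ f σ (x ∷ v) w = begin
  Σ[ concatMap (λ τ → ends τ (v ++ w)) (steps x σ) ] f
    ≡⟨ Σ-concatMap _ f (steps x σ) ⟩
  Σ[ steps x σ ] (λ τ → Σ[ ends τ (v ++ w) ] f)
    ≡⟨ Σ-cong (λ τ → Σ-ends-++ f τ v w) (steps x σ) ⟩
  Σ[ steps x σ ] (λ τ → Σ[ ends τ v ] (λ ρ → Σ[ ends ρ w ] f))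
    ≡⟨ Σ-concatMap _ _ (steps x σ) ⟨
  Σ[ concatMap (λ τ → ends τ v) (steps x σ) ] (λ ρ → Σ[ ends ρ w ] f) ∎
  where open ≡-Reasoning

-- A letter below `y` cannot absorb the tree with root `y`, and this tree blocks access to
-- everything beneath it. The cases reflect that `steps` looks at two roots: `y` is the first of
-- them, the second, or out of sight.
steps-frame : ∀ {x y} → x < y → ∀ ρ τ → steps x (ρ ++ y ∷ τ) ≡ map (_++ y ∷ τ) (steps x ρ)
steps-frame {x} {y} x<y [] τ rewrite dec-false (y <? x) (<⇒≯ x<y) = refl
steps-frame {x} {y} x<y (t ∷ []) τ with does (t <? x)
... | false = refl
... | true rewrite dec-false (y <? x) (<⇒≯ x<y) = refl
steps-frame {x} {y} x<y (t ∷ u ∷ ρ) τ with does (t <? x) | does (u <? x)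
... | false | _     = refl
... | true  | false = refl
... | true  | true  = refl

Σ-ends-frame : ∀ {y w} → All (_< y) w → ∀ f ρ τ →
  Σ[ ends (ρ ++ y ∷ τ) w ] f ≡ Σ[ ends ρ w ] (λ ρ′ → f (ρ′ ++ y ∷ τ))
Σ-ends-frame [] f ρ τ = refl
Σ-ends-frame {y} {x ∷ w} (x<y ∷ w<y) f ρ τ = begin
  Σ[ concatMap (λ σ → ends σ w) (steps x (ρ ++ y ∷ τ)) ] f
    ≡⟨ Σ-concatMap _ f (steps x (ρ ++ y ∷ τ)) ⟩
  Σ[ steps x (ρ ++ y ∷ τ) ] (λ σ → Σ[ ends σ w ] f)
    ≡⟨ cong (λ l → Σ[ l ] (λ σ → Σ[ ends σ w ] f)) (steps-frame x<y ρ τ) ⟩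
  Σ[ map (_++ y ∷ τ) (steps x ρ) ] (λ σ → Σ[ ends σ w ] f)
    ≡⟨ Σ-map (_++ y ∷ τ) _ (steps x ρ) ⟩
  Σ[ steps x ρ ] (λ σ → Σ[ ends (σ ++ y ∷ τ) w ] f)
    ≡⟨ Σ-cong (λ σ → Σ-ends-frame w<y f σ τ) (steps x ρ) ⟩
  Σ[ steps x ρ ] (λ σ → Σ[ ends σ w ] (λ ρ′ → f (ρ′ ++ y ∷ τ)))
    ≡⟨ Σ-concatMap _ _ (steps x ρ) ⟨
  Σ[ concatMap (λ σ → ends σ w) (steps x ρ) ] (λ ρ′ → f (ρ′ ++ y ∷ τ)) ∎
  where open ≡-Reasoning

All-steps : ∀ {P : ℕ → Set} {x σ} → P x → All P σ → All (All P) (steps x σ)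
All-steps px [] = (px ∷ []) ∷ []
All-steps {x = x} {t ∷ σ} px (pt ∷ pσ) with does (t <? x)
... | false = (px ∷ pt ∷ pσ) ∷ []
... | true  = (px ∷ pt ∷ pσ) ∷ (px ∷ pσ) ∷ (px ∷ pσ) ∷ two pσ
  where
  two : ∀ {σ} → All _ σ → All (All _) (joinTwo x σ)
  two [] = []
  two {u ∷ σ} (pu ∷ pσ) with does (u <? x)
  ... | false = []
  ... | true  = (px ∷ pσ) ∷ []

All-ends : ∀ {P : ℕ → Set} {σ w} → All P σ → All P w → All (All P) (ends σ w)
All-ends pσ []        = pσ ∷ []
All-ends pσ (px ∷ pw) = All-concatMap (All.map (λ pτ → All-ends pτ pw) (All-steps px pσ))

Topped : ℕ → List ℕ → Set
Topped x τ = ∃ λ σ → τ ≡ x ∷ σ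

steps-topped : ∀ x σ → All (Topped x) (steps x σ)
steps-topped x [] = (_ , refl) ∷ []
steps-topped x (t ∷ σ) with does (t <? x)
... | false = (_ , refl) ∷ []
... | true  = (_ , refl) ∷ (_ , refl) ∷ (_ , refl) ∷ two σ
  where
  two : ∀ σ → All (Topped x) (joinTwo x σ)
  two [] = []
  two (u ∷ σ) with does (u <? x)
  ... | false = []
  ... | true  = (_ , refl) ∷ []

-- The letter just read is always the topmost root. So the stacks after `a ∷ʳ y` have the form
-- `y ∷ τ` on which `Σ-ends-frame` relies.
ends-topped : ∀ σ w x → All (Topped x) (ends σ (w ∷ʳ x))
ends-topped σ []      x = All-concatMap (All.map (λ p → p ∷ []) (steps-topped x σ))
ends-topped σ (y ∷ w) x = All-concatMap (All.universal (λ τ → ends-topped τ w x) (steps y σ))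

ends-nonempty : ∀ σ x w → All (λ τ → ∃ λ q → length τ ≡ suc q) (ends σ (x ∷ w))
ends-nonempty σ x [] =
  All-concatMap (All.map (λ { (τ , refl) → (_ , refl) ∷ [] }) (steps-topped x σ))
ends-nonempty σ x (y ∷ w) =
  All-concatMap (All.universal (λ τ → ends-nonempty τ y w) (steps x σ))

-- The number of ways to end with at most one tree after m more letters that
-- exceed everything, starting with p trees.
c : ℕ → ℕ → ℕ
c zero    zero          = 1
c zero    (suc zero)    = 1
c zero    (suc (suc p)) = 0
c (suc m) zero          = c m 1
c (suc m) (suc zero)    = c m 2 + 2 * c m 1
c (suc m) (suc (suc p)) = c m (3 + p) + 2 * c m (2 + p) + c m (1 + p)

-- Cut at the first time that the number of trees becomes p + 1, that is, when
-- the q + 1 topmost trees have just been absorbed.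
c-conv : ∀ m p q → c m (2 + (p + q)) ≡ conv (λ j → c j (suc p)) (λ j → c j (suc q)) m
c-conv zero    p       q = refl
-- For fixed `q` both sides obey the recurrence of `c` in `m` and the number of lower trees. When
-- `p` is 0, the drop to `1 + q` trees is not covered by the induction hypothesis; it is the product
-- with first index 0, as `c 0 1` is 1.
c-conv (suc m) zero    q = begin
  c m (3 + q) + 2 * c m (2 + q) + c m (1 + q)
    ≡⟨ cong₂ (λ a b → a + 2 * b + c m (1 + q)) (c-conv m 1 q) (c-conv m 0 q) ⟩
  C 2 + 2 * C 1 + c m (1 + q)
    ≡⟨ cong (λ a → C 2 + a + c m (1 + q)) (conv-*ˡ 2 (λ j → c j 1) b m) ⟨
  C 2 + conv (λ j → 2 * c j 1) b m + c m (1 + q)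
    ≡⟨ cong (_+ c m (1 + q)) (conv-+ˡ (λ j → c j 2) (λ j → 2 * c j 1) b m) ⟨
  conv (λ j → c (suc j) 1) b m + c m (1 + q)
    ≡⟨ +-comm _ (c m (1 + q)) ⟩
  c m (1 + q) + conv (λ j → c (suc j) 1) b m
    ≡⟨ cong (_+ conv (λ j → c (suc j) 1) b m) (+-identityʳ (c m (1 + q))) ⟨
  1 * c m (1 + q) + conv (λ j → c (suc j) 1) b m ∎
  where
  open ≡-Reasoning
  b : ℕ → ℕ
  b j = c j (suc q)
  C : ℕ → ℕ
  C p = conv (λ j → c j p) b m
c-conv (suc m) (suc p) q = begin
  c m (4 + (p + q)) + 2 * c m (3 + (p + q)) + c m (2 + (p + q))
    ≡⟨ cong₂ _+_ (cong₂ (λ a b → a + 2 * b) (c-conv m (2 + p) q) (c-conv m (1 + p) q)) (c-conv m p q) ⟩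
  C (3 + p) + 2 * C (2 + p) + C (1 + p)
    ≡⟨ cong (λ a → C (3 + p) + a + C (1 + p)) (conv-*ˡ 2 (λ j → c j (2 + p)) b m) ⟨
  C (3 + p) + conv (λ j → 2 * c j (2 + p)) b m + C (1 + p)
    ≡⟨ cong (_+ C (1 + p)) (conv-+ˡ (λ j → c j (3 + p)) (λ j → 2 * c j (2 + p)) b m) ⟨
  conv (λ j → c j (3 + p) + 2 * c j (2 + p)) b m + C (1 + p)
    ≡⟨ conv-+ˡ (λ j → c j (3 + p) + 2 * c j (2 + p)) (λ j → c j (1 + p)) b m ⟨
  conv (λ j → c (suc j) (2 + p)) b m ∎
  where
  open ≡-Reasoning
  b : ℕ → ℕ
  b j = c j (suc q)
  C : ℕ → ℕ
  C p = conv (λ j → c j p) b m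

c-doubling : ∀ p → Doubling (λ j → c j (suc p))
c-doubling zero    j = m≤n+m (2 * c j 1) (c j 2)
c-doubling (suc p) j =
  ≤-trans (m≤n+m (2 * c j (2 + p)) (c j (3 + p))) (m≤m+n _ (c j (1 + p)))

-- The shift of the index rescues `p = 0`: `c (suc j) 0` is `c j 1`, whereas `c 0 0` and `c 1 0` are
-- both 1.
c-suc-doubling : ∀ p → Doubling (λ j → c (suc j) p)
c-suc-doubling zero    j = c-doubling 0 j
c-suc-doubling (suc p) j = c-doubling p (suc j)

-- A letter above all roots passes every test in `steps`, so the entries of `steps x σ` match the
-- summands in the recurrence of `c`.
Σ-steps-c : ∀ {x σ} → All (_< x) σ → ∀ j → Σ[ steps x σ ] (c j ∘ length) ≡ c (suc j) (length σ)
Σ-steps-c [] j = +-identityʳ _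
Σ-steps-c {x} {t ∷ []} (t<x ∷ []) j rewrite dec-true (t <? x) t<x = refl
Σ-steps-c {x} {t ∷ u ∷ σ} (t<x ∷ u<x ∷ _) j
  rewrite dec-true (t <? x) t<x | dec-true (u <? x) u<x =
  regroup (c j (3 + length σ)) (c j (2 + length σ)) (c j (1 + length σ))
  where
  regroup : ∀ a b d → a + (b + (b + (d + 0))) ≡ a + 2 * b + d
  regroup = solve-∀

-- The number of preimages of w followed by j larger letters in increasing order.
h : List ℕ → ℕ → ℕ
h w j = Σ[ ends [] w ] (c j ∘ length)

h-∷ʳ : ∀ {x w} → All (_< x) w → ∀ j → h (w ∷ʳ x) j ≡ h w (suc j)
h-∷ʳ {x} {w} w<x j = begin
  h (w ∷ʳ x) j
    ≡⟨ Σ-ends-++ (c j ∘ length) [] w (x ∷ []) ⟩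
  Σ[ ends [] w ] (λ τ → Σ[ concatMap [_] (steps x τ) ] (c j ∘ length))
    ≡⟨ Σ-cong (λ τ → cong (λ l → Σ[ l ] (c j ∘ length)) (concatMap-pure (steps x τ))) (ends [] w) ⟩
  Σ[ ends [] w ] (λ τ → Σ[ steps x τ ] (c j ∘ length))
    ≡⟨ Σ-cong-All (All.map (λ τ<x → Σ-steps-c τ<x j) (All-ends [] w<x)) ⟩
  h w (suc j) ∎
  where open ≡-Reasoning

-- While `B` is read, `y` shields the trees of `a`, so the two stacks evolve independently and
-- `c-conv` applies to their sizes. The `suc` on the side of `a` is the letter `y`, the first larger
-- letter after `a`.
h-conv : ∀ {y a b₀ b} → All (_< y) a → All (_< y) (b₀ ∷ b) → ∀ m →
  h (a ++ y ∷ b₀ ∷ b) m ≡ conv (h a ∘ suc) (h (b₀ ∷ b)) m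
h-conv {y} {a} {b₀} {b} a<y b<y m = begin
  h (a ++ y ∷ B) m
    ≡⟨ cong (λ w → h w m) (++-assoc a (y ∷ []) B) ⟨
  h (a ∷ʳ y ++ B) m
    ≡⟨ Σ-ends-++ (c m ∘ length) [] (a ∷ʳ y) B ⟩
  Σ[ ends [] (a ∷ʳ y) ] (λ τ → Σ[ ends τ B ] (c m ∘ length))
    ≡⟨ Σ-cong-All (All.map first (ends-topped [] a y)) ⟩
  Σ[ ends [] (a ∷ʳ y) ] (λ τ → Σ[ ends [] B ] (λ ρ → conv (λ j → c j (length τ)) (λ j → c j (length ρ)) m))
    ≡⟨ conv-Σ (λ τ j → c j (length τ)) (λ ρ j → c j (length ρ)) (ends [] (a ∷ʳ y)) (ends [] B) m ⟩
  conv (h (a ∷ʳ y)) (h B) m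
    ≡⟨ conv-congˡ (h B) m (h-∷ʳ a<y) ⟩
  conv (h a ∘ suc) (h B) m ∎
  where
  open ≡-Reasoning
  B : List ℕ
  B = b₀ ∷ b
  size : ∀ ρ (τ : List ℕ) {q} → length ρ ≡ suc q →
    length (ρ ++ y ∷ τ) ≡ 2 + (length τ + q)
  size ρ τ {q} eq = begin
    length (ρ ++ y ∷ τ)          ≡⟨ length-++ ρ ⟩
    length ρ + suc (length τ)    ≡⟨ cong (_+ suc (length τ)) eq ⟩
    suc q + suc (length τ)       ≡⟨ cong suc (+-suc q (length τ)) ⟩
    2 + (q + length τ)           ≡⟨ cong (2 +_) (+-comm q (length τ)) ⟩
    2 + (length τ + q)           ∎
  second : ∀ τ ρ → (∃ λ q → length ρ ≡ suc q) →
    c m (length (ρ ++ y ∷ τ)) ≡ conv (λ j → c j (suc (length τ))) (λ j → c j (length ρ)) m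
  second τ ρ (q , eq) = begin
    c m (length (ρ ++ y ∷ τ))      ≡⟨ cong (c m) (size ρ τ eq) ⟩
    c m (2 + (length τ + q))       ≡⟨ c-conv m (length τ) q ⟩
    conv (λ j → c j (suc (length τ))) (λ j → c j (suc q)) m
      ≡⟨ cong (λ l → conv (λ j → c j (suc (length τ))) (λ j → c j l) m) eq ⟨
    conv (λ j → c j (suc (length τ))) (λ j → c j (length ρ)) m ∎
  first : ∀ {τ} → Topped y τ → Σ[ ends τ B ] (c m ∘ length) ≡
    Σ[ ends [] B ] (λ ρ → conv (λ j → c j (length τ)) (λ j → c j (length ρ)) m)
  first (τ , refl) = trans (Σ-ends-frame b<y (c m ∘ length) [] τ)
    (Σ-cong-All (All.map (λ {ρ} → second τ ρ) (ends-nonempty [] b₀ b)))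

h-suc-doubling : ∀ w → Doubling (h w ∘ suc)
h-suc-doubling w j = ≤-trans (≤-reflexive (sym (Σ-*ˡ 2 (c (suc j) ∘ length) (ends [] w))))
  (Σ-mono-All (All.universal (λ τ → c-suc-doubling (length τ) j) (ends [] w)))

h-doubling : ∀ x w → Doubling (h (x ∷ w))
h-doubling x w j = ≤-trans (≤-reflexive (sym (Σ-*ˡ 2 (c j ∘ length) (ends [] (x ∷ w)))))
  (Σ-mono-All (All.map (λ { {τ} (q , eq) → subst (λ p → 2 * c j p ≤ c (suc j) p) (sym eq) (c-doubling q j) })
    (ends-nonempty [] x w)))

δ-h : ∀ {y a b₀ b} → All (_< y) a → All (_< y) (b₀ ∷ b) → ∀ m →
  δ 1 (h (a ++ y ∷ b₀ ∷ b) m) ≡ conv (δ 1 ∘ h a ∘ suc) (δ 1 ∘ h (b₀ ∷ b)) m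
δ-h {a = a} {b₀} {b} a<y b<y m = trans (cong (δ 1) (h-conv a<y b<y m))
  (δ-conv (h a ∘ suc) (h (b₀ ∷ b)) (h-suc-doubling a) (h-doubling b₀ b) m)

-- Invariance under order isomorphism

OrderIso : (ℕ → ℕ → Set) → Set
OrderIso R = ∀ {a a′ b b′} → R a a′ → R b b′ → does (a <? b) ≡ does (a′ <? b′)

module _ {R : ℕ → ℕ → Set} (iso : OrderIso R) where

  steps-iso : ∀ {x x′ σ σ′} → R x x′ → Pointwise R σ σ′ →
    Pointwise (Pointwise R) (steps x σ) (steps x′ σ′)
  steps-iso rx [] = (rx ∷ []) ∷ []
  steps-iso {x} {x′} {t ∷ _} {t′ ∷ _} rx (rt ∷ rσ)
    with does (t <? x) | does (t′ <? x′) | iso rt rx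
  ... | false | _ | refl = (rx ∷ rt ∷ rσ) ∷ []
  ... | true  | _ | refl = (rx ∷ rt ∷ rσ) ∷ (rx ∷ rσ) ∷ (rx ∷ rσ) ∷ two rσ
    where
    two : ∀ {σ σ′} → Pointwise R σ σ′ → Pointwise (Pointwise R) (joinTwo x σ) (joinTwo x′ σ′)
    two [] = []
    two {u ∷ _} {u′ ∷ _} (ru ∷ rσ) with does (u <? x) | does (u′ <? x′) | iso ru rx
    ... | false | _ | refl = []
    ... | true  | _ | refl = (rx ∷ rσ) ∷ []

  ends-iso : ∀ {σ σ′ w w′} → Pointwise R σ σ′ → Pointwise R w w′ →
    Pointwise (Pointwise R) (ends σ w) (ends σ′ w′)
  ends-iso rσ []        = rσ ∷ []
  ends-iso rσ (rx ∷ rw) = Pointwise.concat⁺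
    (Pointwise.map⁺ _ _ (Pointwise.map (λ rτ → ends-iso rτ rw) (steps-iso rx rσ)))

  -- Parsing uses letters only through comparisons, so related words produce stacks of the same
  -- sizes in the same order.
  h-iso : ∀ {w w′} → Pointwise R w w′ → ∀ j → h w j ≡ h w′ j
  h-iso rw j = Σ-cong-Pointwise (cong (c j) ∘ Pointwise.Pointwise-length) (ends-iso [] rw)

-- Permutations, splittings and tails

Unique-resp-↭ : ∀ {xs ys : List X} → xs ↭ ys → Unique xs → Unique ys
Unique-resp-↭ {X = X} p = ↭ₛ.Unique-resp-↭ (setoid X) (↭⇒↭ₛ p)

unique∧set⇒↭ : ∀ {xs ys : List X} → Unique xs → Unique ys → xs ⊆ ys → ys ⊆ xs → xs ↭ ys
unique∧set⇒↭ uxs uys xs⊆ys ys⊆xs = ∼bag⇒↭ (unique∧set⇒bag uxs uys (mk⇔ xs⊆ys ys⊆xs))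

-- Pigeonhole: each entry of `xs` uses up one place of `ys`, and the bound on the length leaves no
-- place over.
unique∧⊆⇒↭ : ∀ {xs ys : List X} → Unique xs → xs ⊆ ys → length ys ≤ length xs → xs ↭ ys
unique∧⊆⇒↭ {xs = []} {[]} _ _ _ = ↭-refl
unique∧⊆⇒↭ {xs = x ∷ xs} {ys} uxs@(_ ∷ u) xs⊆ys len with ∈-∃++ (xs⊆ys (here refl))
... | as , bs , refl = ↭-trans (prep x (unique∧⊆⇒↭ u xs⊆ (s≤s⁻¹ (subst (_≤ suc (length xs)) (↭.↭-length move) len)))) (↭-sym move)
  where
  move : as ++ x ∷ bs ↭ x ∷ as ++ bs
  move = ↭.shift x as bs
  xs⊆ : xs ⊆ as ++ bs
  xs⊆ z∈ with ↭.∈-resp-↭ move (xs⊆ys (there z∈))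
  ... | here refl = contradiction z∈ (Unique.Unique[x∷xs]⇒x∉xs uxs)
  ... | there z∈′ = z∈′

Unique-map : ∀ {f : X → Y} {xs} → (∀ {a b} → a ∈ xs → b ∈ xs → f a ≡ f b → a ≡ b) →
  Unique xs → Unique (map f xs)
Unique-map inj [] = []
Unique-map inj (x∉ ∷ u) =
  All.map⁺ (All.tabulate (λ a∈ eq → All.lookup x∉ a∈ (inj (here refl) (there a∈) eq))) ∷
  Unique-map (λ a∈ b∈ → inj (there a∈) (there b∈)) u

Unique-concatMap : ∀ {f : X → List Y} {xs} →
  (∀ {a b z} → a ∈ xs → b ∈ xs → z ∈ f a → z ∈ f b → a ≡ b) →
  All (Unique ∘ f) xs → Unique xs → Unique (concatMap f xs)
Unique-concatMap inj [] [] = []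
Unique-concatMap {f = f} {x ∷ xs} inj (ux ∷ us) (x∉ ∷ u) =
  Unique.++⁺ ux (Unique-concatMap (λ a∈ b∈ → inj (there a∈) (there b∈)) us u) disjoint
  where
  disjoint : ∀ {z} → ¬ (z ∈ f x × z ∈ concatMap f xs)
  disjoint (z∈fx , z∈) with ∈-concat⁻′ (map f xs) z∈
  ... | _ , z∈l , l∈ with ∈-map⁻ f l∈
  ... | a , a∈ , refl = All.lookup x∉ a∈ (inj (here refl) (there a∈) z∈fx z∈l)

∈-concatMap : ∀ {f : X → List Y} {xs a z} → a ∈ xs → z ∈ f a → z ∈ concatMap f xs
∈-concatMap {f = f} a∈ z∈ = ∈-concat⁺′ z∈ (∈-map⁺ f a∈)

splits : List X → List (List X × List X)
splits []      = ([] , []) ∷ []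
splits (x ∷ w) = ([] , x ∷ w) ∷ map (map₁ (x ∷_)) (splits w)

insert : X → List X × List X → List X
insert x (a , b) = a ++ x ∷ b

perms : List X → List (List X)
perms []      = [] ∷ []
perms (x ∷ v) = concatMap (map (insert x) ∘ splits) (perms v)

splits-++ : ∀ (w : List X) → All (λ p → proj₁ p ++ proj₂ p ≡ w) (splits w)
splits-++ []      = refl ∷ []
splits-++ (x ∷ w) = refl ∷ All.map⁺ (All.map (cong (x ∷_)) (splits-++ w))

∈-splits : ∀ (a b : List X) → (a , b) ∈ splits (a ++ b)
∈-splits []      []      = here refl
∈-splits []      (x ∷ b) = here refl
∈-splits (x ∷ a) b       = there (∈-map⁺ (map₁ (x ∷_)) (∈-splits a b))

Unique-splits : ∀ (w : List X) → Unique (splits w)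
Unique-splits []      = [] ∷ []
Unique-splits (x ∷ w) =
  All.map⁺ (All.universal (λ _ ()) (splits w)) ∷ Unique.map⁺ (λ { refl → refl }) (Unique-splits w)

insert-↭ : ∀ (x : X) (a b : List X) → insert x (a , b) ↭ x ∷ a ++ b
insert-↭ = ↭.shift

perms-↭ : ∀ (v : List X) → All (_↭ v) (perms v)
perms-↭ []      = ↭-refl ∷ []
perms-↭ (x ∷ v) = All-concatMap (All.map grow (perms-↭ v))
  where
  grow : ∀ {w} → w ↭ v → All (_↭ x ∷ v) (map (insert x) (splits w))
  grow {w} w↭v = All.map⁺ (All.map (λ { {a , b} refl → ↭-trans (insert-↭ x a b) (prep x w↭v) })
    (splits-++ w))

∈-perms : ∀ (v : List X) {w} → w ↭ v → w ∈ perms v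
∈-perms [] w↭v rewrite ↭.↭-empty-inv w↭v = here refl
∈-perms (x ∷ v) w↭v with ∈-∃++ (↭.∈-resp-↭ (↭-sym w↭v) (here refl))
... | a , b , refl = ∈-concatMap (∈-perms v (↭.drop-mid a [] w↭v)) (∈-map⁺ (insert x) (∈-splits a b))

insert-injective : ∀ {x : X} (a a′ : List X) {b b′} → x ∉ a → x ∉ a′ →
  a ++ x ∷ b ≡ a′ ++ x ∷ b′ → a ≡ a′ × b ≡ b′
insert-injective []      []       x∉a x∉a′ refl = refl , refl
insert-injective []      (y ∷ a′) x∉a x∉a′ refl = contradiction (here refl) x∉a′
insert-injective (y ∷ a) []       x∉a x∉a′ refl = contradiction (here refl) x∉a
insert-injective (y ∷ a) (z ∷ a′) x∉a x∉a′ eq with ∷-injective eq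
... | refl , eq′ with insert-injective a a′ (x∉a ∘ there) (x∉a′ ∘ there) eq′
...   | refl , refl = refl , refl

Unique-perms : ∀ {v : List X} → Unique v → Unique (perms v)
Unique-perms {v = []}    _           = [] ∷ []
Unique-perms {X = X} {v = x ∷ v} ux@(_ ∷ u) =
  Unique-concatMap same (All.tabulate (λ {w} w∈ → Unique-map (inj w∈ w∈) (Unique-splits w))) (Unique-perms u)
  where
  ∉-part : ∀ {w p} → w ∈ perms v → p ∈ splits w → x ∉ proj₁ p
  ∉-part {w} {a , b} w∈ p∈ x∈a = Unique.Unique[x∷xs]⇒x∉xs ux
    (↭.∈-resp-↭ (All.lookup (perms-↭ v) w∈)
      (subst (x ∈_) (All.lookup (splits-++ w) p∈) (∈-++⁺ˡ x∈a)))
  inj : ∀ {w w′ p q} → w ∈ perms v → w′ ∈ perms v → p ∈ splits w → q ∈ splits w′ →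
    insert x p ≡ insert x q → p ≡ q
  inj {p = a , _} {a′ , _} w∈ w′∈ p∈ q∈ eq
    with insert-injective a a′ (∉-part w∈ p∈) (∉-part w′∈ q∈) eq
  ... | refl , refl = refl
  same : ∀ {w w′ z} → w ∈ perms v → w′ ∈ perms v →
    z ∈ map (insert x) (splits w) → z ∈ map (insert x) (splits w′) → w ≡ w′
  same {w} {w′} w∈ w′∈ z∈ z∈′ with ∈-map⁻ (insert x) z∈ | ∈-map⁻ (insert x) z∈′
  ... | p , p∈ , refl | q , q∈ , eq with inj w∈ w′∈ p∈ q∈ eq
  ...   | refl = trans (sym (All.lookup (splits-++ w) p∈)) (All.lookup (splits-++ w′) q∈)

Σ-perms-∷ : ∀ (f : List X → ℕ) x v →
  Σ[ perms (x ∷ v) ] f ≡ Σ[ perms v ] (λ w → Σ[ splits w ] (f ∘ insert x))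
Σ-perms-∷ f x v = trans (Σ-concatMap _ f (perms v)) (Σ-cong (λ w → Σ-map (insert x) f (splits w)) (perms v))

Σ-splits-last : ∀ (w : List X) (f : List X × List X → ℕ) →
  (∀ a b₀ b → a ++ b₀ ∷ b ≡ w → f (a , b₀ ∷ b) ≡ 0) → Σ[ splits w ] f ≡ f (w , [])
Σ-splits-last []      f zer = +-identityʳ (f ([] , []))
Σ-splits-last (x ∷ w) f zer = cong₂ _+_ (zer [] x w refl)
  (trans (Σ-map (map₁ (x ∷_)) f (splits w))
    (Σ-splits-last w (f ∘ map₁ (x ∷_)) (λ a b₀ b eq → zer (x ∷ a) b₀ b (cong (x ∷_) eq))))

-- In decreasing order, `perms` inserts the largest letter last, so that `Σ-perms-∷` splits a
-- permutation at its maximum.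
D : ℕ → List ℕ
D = applyDownFrom suc

D-↭ : ∀ n → D n ↭ [ 1 ⋯ n ]
D-↭ n = ↭-trans (↭-sym (↭.↭-reverse (D n)))
  (subst (reverse (D n) ↭_) (reverse-applyDownFrom suc n) ↭-refl)

D-decreasing : ∀ n → AllPairs _>_ (D n)
D-decreasing n = AllPairs.applyDownFrom⁺₁ suc n (λ j<i _ → s<s j<i)

D-< : ∀ n → All (_< suc n) (D n)
D-< n = All.applyDownFrom⁺₁ suc n s<s

length-D : ∀ n → length (D n) ≡ n
length-D = length-applyDownFrom suc

words-↔ : ∀ k {A w} → w ∈ words k A → length w ≡ k × w ⊆ A
words-↔ zero    (here refl) = refl , λ ()
words-↔ (suc k) {A} w∈ with ∈-cartesianProductWith⁻ _∷_ A (words k A) w∈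
... | x , v , x∈ , v∈ , refl with words-↔ k v∈
...   | refl , v⊆ = refl , λ { (here refl) → x∈ ; (there z∈) → v⊆ z∈ }

∈-words : ∀ {A} w → w ⊆ A → w ∈ words (length w) A
∈-words []      _  = here refl
∈-words (x ∷ w) w⊆ = ∈-cartesianProductWith⁺ _∷_ (w⊆ (here refl)) (∈-words w (w⊆ ∘ there))

Unique-words : ∀ k {A} → Unique A → Unique (words k A)
Unique-words zero    u = [] ∷ []
Unique-words (suc k) u = Unique.cartesianProductWith⁺ _∷_ ∷-injective u (Unique-words k u)

Unique-[1⋯_] : ∀ n → Unique [ 1 ⋯ n ]
Unique-[1⋯ n ] = Unique.applyUpTo⁺₁ suc n (λ i<j _ → <⇒≢ (s<s i<j))

Unique-S : ∀ n → Unique (S n)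
Unique-S n = Unique.filter⁺ unique? (Unique-words n Unique-[1⋯ n ])

length-[1⋯_] : ∀ n → length [ 1 ⋯ n ] ≡ n
length-[1⋯ n ] = length-applyUpTo suc n

∈S⇒↭ : ∀ {n w} → w ∈ S n → w ↭ [ 1 ⋯ n ]
∈S⇒↭ {n} w∈S with ∈-filter⁻ unique? {xs = words n [ 1 ⋯ n ]} w∈S
... | w∈ , u with words-↔ n w∈
...   | len , w⊆ = unique∧⊆⇒↭ u w⊆ (≤-reflexive (trans length-[1⋯ n ] (sym len)))

↭⇒∈S : ∀ {n w} → w ↭ [ 1 ⋯ n ] → w ∈ S n
↭⇒∈S {n} {w} w↭ = ∈-filter⁺ unique?
  (subst (λ k → w ∈ words k [ 1 ⋯ n ]) (trans (↭.↭-length w↭) length-[1⋯ n ]) (∈-words w (↭.∈-resp-↭ w↭)))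
  (Unique-resp-↭ (↭-sym w↭) Unique-[1⋯ n ])

S-↭-perms : ∀ n → S n ↭ perms (D n)
S-↭-perms n = unique∧set⇒↭ (Unique-S n)
  (Unique-perms (Unique-resp-↭ (↭-sym (D-↭ n)) Unique-[1⋯ n ]))
  (λ w∈ → ∈-perms (D n) (↭-trans (∈S⇒↭ w∈) (↭-sym (D-↭ n))))
  (λ w∈ → ↭⇒∈S (↭-trans (All.lookup (perms-↭ (D n)) w∈) (D-↭ n)))

-- Distributing letters over two words, and binomial coefficients

parts : List X → List (List X × List X)
parts []      = ([] , []) ∷ []
parts (x ∷ v) = concatMap (λ (y , z) → (x ∷ y , z) ∷ (y , x ∷ z) ∷ []) (parts v)

Σ-parts-∷ : ∀ (f : List X × List X → ℕ) x v →
  Σ[ parts (x ∷ v) ] f ≡ Σ[ parts v ] (λ (y , z) → f (x ∷ y , z) + f (y , x ∷ z))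
Σ-parts-∷ f x v = trans (Σ-concatMap _ f (parts v))
  (Σ-cong (λ (y , z) → cong (f (x ∷ y , z) +_) (+-identityʳ (f (y , x ∷ z)))) (parts v))

-- Inserting `x` and then cutting amounts to cutting and then inserting `x` into one of the two
-- sides.
Σ-splits-insert : ∀ (x : X) w (f : List X × List X → ℕ) →
  Σ[ splits w ] (λ p → Σ[ splits (insert x p) ] f) ≡
  Σ[ splits w ] (λ (a , b) → Σ[ splits a ] (λ p → f (insert x p , b)) + Σ[ splits b ] (λ p → f (a , insert x p)))
Σ-splits-insert x [] f = regroup (f ([] , x ∷ [])) (f (x ∷ [] , []))
  where
  regroup : ∀ s t → s + (t + 0) + 0 ≡ t + 0 + (s + 0) + 0
  regroup = solve-∀
Σ-splits-insert {X = X} x (y ∷ w) f = begin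
  f ([] , x ∷ y ∷ w) + Σ[ map (map₁ (x ∷_)) (splits (y ∷ w)) ] f
    + Σ[ map (map₁ (y ∷_)) (splits w) ] (λ p → Σ[ splits (insert x p) ] f)
    ≡⟨ cong₂ (λ s t → f ([] , x ∷ y ∷ w) + s + t)
         (trans (Σ-map (map₁ (x ∷_)) f (splits (y ∷ w)))
           (cong (f (x ∷ [] , y ∷ w) +_) (Σ-map (map₁ (y ∷_)) _ (splits w))))
         (trans (Σ-map (map₁ (y ∷_)) _ (splits w))
           (trans (Σ-+ (λ (a , b) → f ([] , y ∷ a ++ x ∷ b)) _ (splits w))
             (cong (Σ[ splits w ] (λ p → f ([] , y ∷ insert x p)) +_)
               (trans (Σ-cong (λ p → Σ-map (map₁ (y ∷_)) f (splits (insert x p))) (splits w))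
                      (Σ-splits-insert x w (f ∘ map₁ (y ∷_))))))) ⟩
  f ([] , x ∷ y ∷ w) + (f (x ∷ [] , y ∷ w) + P) + (Q + R)
    ≡⟨ regroup (f ([] , x ∷ y ∷ w)) (f (x ∷ [] , y ∷ w)) P Q R ⟩
  f (x ∷ [] , y ∷ w) + 0 + (f ([] , x ∷ y ∷ w) + Q) + (P + R)
    ≡⟨ cong₂ (λ s t → f (x ∷ [] , y ∷ w) + 0 + (f ([] , x ∷ y ∷ w) + s) + t)
         (Σ-map (map₁ (y ∷_)) _ (splits w))
         (trans (Σ-map (map₁ (y ∷_)) _ (splits w))
           (trans (Σ-cong (λ (a , b) → trans
               (cong (λ s → f (x ∷ y ∷ a , b) + s + Σ[ splits b ] (λ p → f (y ∷ a , insert x p)))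
                 (Σ-map (map₁ (y ∷_)) (λ p → f (insert x p , b)) (splits a)))
               (+-assoc (f (x ∷ y ∷ a , b)) _ _)) (splits w))
             (Σ-+ (λ (a , b) → f (x ∷ y ∷ a , b)) _ (splits w)))) ⟨
  _ ∎
  where
  open ≡-Reasoning
  P Q R : ℕ
  P = Σ[ splits w ] (λ (a , b) → f (x ∷ y ∷ a , b))
  Q = Σ[ splits w ] (λ p → f ([] , y ∷ insert x p))
  R = Σ[ splits w ] (λ (a , b) → Σ[ splits a ] (λ p → f (y ∷ insert x p , b))
                               + Σ[ splits b ] (λ p → f (y ∷ a , insert x p)))
  regroup : ∀ s t p q r → s + (t + p) + (q + r) ≡ t + 0 + (s + q) + (p + r)
  regroup = solve-∀

-- A permutation cut in two is a choice of the letters on the left together with an arrangement of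
-- each side; in the induction, `x` goes to the side into which it is inserted.
Σ-perms-splits : ∀ v (f : List X × List X → ℕ) →
  Σ[ perms v ] (λ w → Σ[ splits w ] f) ≡
  Σ[ parts v ] (λ (y , z) → Σ[ perms y ] (λ a → Σ[ perms z ] (λ b → f (a , b))))
Σ-perms-splits []      f = sym (cong (_+ 0) (+-identityʳ (f ([] , []) + 0)))
Σ-perms-splits (x ∷ v) f = begin
  Σ[ perms (x ∷ v) ] (λ w → Σ[ splits w ] f)
    ≡⟨ Σ-perms-∷ _ x v ⟩
  Σ[ perms v ] (λ w → Σ[ splits w ] (λ p → Σ[ splits (insert x p) ] f))
    ≡⟨ Σ-cong (λ w → Σ-splits-insert x w f) (perms v) ⟩
  Σ[ perms v ] (λ w → Σ[ splits w ] (λ p → L p + R p))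
    ≡⟨ Σ-perms-splits v _ ⟩
  Σ[ parts v ] (λ (y , z) → Σ[ perms y ] (λ a → Σ[ perms z ] (λ b → L (a , b) + R (a , b))))
    ≡⟨ Σ-cong (λ (y , z) → trans (Σ-cong (λ a → Σ-+ _ _ (perms z)) (perms y))
         (trans (Σ-+ _ _ (perms y)) (cong₂ _+_ (left y z) (right y z)))) (parts v) ⟩
  Σ[ parts v ] (λ (y , z) →
    Σ[ perms (x ∷ y) ] (λ a → Σ[ perms z ] (λ b → f (a , b))) +
    Σ[ perms y ] (λ a → Σ[ perms (x ∷ z) ] (λ b → f (a , b))))
    ≡⟨ Σ-parts-∷ _ x v ⟨
  _ ∎
  where
  open ≡-Reasoning
  L R : List _ × List _ → ℕ
  L (a , b) = Σ[ splits a ] (λ p → f (insert x p , b))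
  R (a , b) = Σ[ splits b ] (λ p → f (a , insert x p))
  left : ∀ y z → Σ[ perms y ] (λ a → Σ[ perms z ] (λ b → L (a , b))) ≡
    Σ[ perms (x ∷ y) ] (λ a → Σ[ perms z ] (λ b → f (a , b)))
  left y z = trans
    (Σ-cong (λ a → Σ-swap (λ b p → f (insert x p , b)) (perms z) (splits a)) (perms y))
    (sym (Σ-perms-∷ _ x y))
  right : ∀ y z → Σ[ perms y ] (λ a → Σ[ perms z ] (λ b → R (a , b))) ≡
    Σ[ perms y ] (λ a → Σ[ perms (x ∷ z) ] (λ b → f (a , b)))
  right y z = Σ-cong (λ a → sym (Σ-perms-∷ (λ b → f (a , b)) x z)) (perms y)

parts-All : ∀ {P : X → Set} {v} → All P v → All (λ (y , z) → All P y × All P z) (parts v)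
parts-All []        = ([] , []) ∷ []
parts-All (px ∷ pv) = All-concatMap
  (All.map (λ (py , pz) → (px ∷ py , pz) ∷ (py , px ∷ pz) ∷ []) (parts-All pv))

parts-AllPairs : ∀ {R : X → X → Set} {v} → AllPairs R v →
  All (λ (y , z) → AllPairs R y × AllPairs R z) (parts v)
parts-AllPairs []        = ([] , []) ∷ []
parts-AllPairs (rx ∷ rv) = All-concatMap
  (All.zipWith (λ ((xy , xz) , (ry , rz)) → (xy ∷ ry , rz) ∷ (ry , xz ∷ rz) ∷ [])
    (parts-All rx , parts-AllPairs rv))

-- Pascal's rule weighted by `F`: the new letter goes to the left in the first sum and to the right
-- in the second.
Σ-C-suc : ∀ k (F : ℕ → ℕ → ℕ) →
  Σ[ upTo (suc k) ] (λ a → (k C a) * F (suc a) (k ∸ a)) + Σ[ upTo (suc k) ] (λ a → (k C a) * F a (suc (k ∸ a)))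
  ≡ Σ[ upTo (2 + k) ] (λ a → (suc k C a) * F a (suc k ∸ a))
Σ-C-suc k F = begin
  Σ[ upTo (suc k) ] p + Σ[ upTo (suc k) ] (λ a → (k C a) * F a (suc (k ∸ a)))
    ≡⟨ cong (Σ[ upTo (suc k) ] p +_) (Σ-applyUpTo-cong {f = id} {g = id} {G = r} (suc k)
         (λ {a} a<1+k → cong (λ b → (k C a) * F a b) (sym (+-∸-assoc 1 (s≤s⁻¹ a<1+k))))) ⟩
  Σ[ upTo (suc k) ] p + Σ[ upTo (suc k) ] r
    -- A term with coefficient `k C suc k`, which is 0, is appended so that the second sum can shed
    -- its term at 0 and be aligned with the first.
    ≡⟨ cong (Σ[ upTo (suc k) ] p +_)
         (trans (cong (Σ[ upTo (suc k) ] r +_) vanish) (+-identityʳ (Σ[ upTo (suc k) ] r))) ⟨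
  Σ[ upTo (suc k) ] p + (Σ[ upTo (suc k) ] r + r (suc k))
    ≡⟨ cong (Σ[ upTo (suc k) ] p +_) (Σ-upTo-last r (suc k)) ⟨
  Σ[ upTo (suc k) ] p + (r 0 + Σ[ applyUpTo suc (suc k) ] r)
    ≡⟨ cong (λ t → Σ[ upTo (suc k) ] p + (r 0 + t))
         (Σ-applyUpTo-cong {f = suc} {g = id} {F = r} {G = q} (suc k) (λ _ → refl)) ⟩
  Σ[ upTo (suc k) ] p + (r 0 + Σ[ upTo (suc k) ] q)
    ≡⟨ regroup (Σ[ upTo (suc k) ] p) (r 0) (Σ[ upTo (suc k) ] q) ⟩
  r 0 + (Σ[ upTo (suc k) ] p + Σ[ upTo (suc k) ] q)
    ≡⟨ cong (r 0 +_) (Σ-+ p q (upTo (suc k))) ⟨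
  r 0 + Σ[ upTo (suc k) ] (λ a → p a + q a)
    ≡⟨ cong (r 0 +_) (Σ-applyUpTo-cong {f = id} {g = suc} {G = λ a → (suc k C a) * F a (suc k ∸ a)} (suc k) (λ {a} _ →
         trans (sym (*-distribʳ-+ (F (suc a) (k ∸ a)) (k C a) (k C suc a)))
               (cong (_* F (suc a) (k ∸ a)) (nCk+nC[k+1]≡[n+1]C[k+1] k a)))) ⟩
  r 0 + Σ[ applyUpTo suc (suc k) ] (λ a → (suc k C a) * F a (suc k ∸ a)) ∎
  where
  open ≡-Reasoning
  p q r : ℕ → ℕ
  p a = (k C a) * F (suc a) (k ∸ a)
  q a = (k C suc a) * F (suc a) (k ∸ a)
  r a = (k C a) * F a (suc k ∸ a)
  vanish : r (suc k) ≡ 0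
  vanish = cong (_* F (suc k) (suc k ∸ suc k)) (k>n⇒nCk≡0 (n<1+n k))
  regroup : ∀ a b c → a + (b + c) ≡ b + (a + c)
  regroup = solve-∀

Σ-parts-length : ∀ (F : ℕ → ℕ → ℕ) (v : List X) →
  Σ[ parts v ] (λ (y , z) → F (length y) (length z)) ≡
  Σ[ upTo (suc (length v)) ] (λ a → (length v C a) * F a (length v ∸ a))
Σ-parts-length F []      = cong (_+ 0) (sym (+-identityʳ (F 0 0)))
Σ-parts-length F (x ∷ v) = begin
  Σ[ parts (x ∷ v) ] (λ (y , z) → F (length y) (length z))
    ≡⟨ Σ-parts-∷ _ x v ⟩
  Σ[ parts v ] (λ (y , z) → F (suc (length y)) (length z) + F (length y) (suc (length z)))
    ≡⟨ Σ-+ _ _ (parts v) ⟩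
  _ ≡⟨ cong₂ _+_ (Σ-parts-length (F ∘ suc) v) (Σ-parts-length (λ a → F a ∘ suc) v) ⟩
  _ ≡⟨ Σ-C-suc (length v) F ⟩
  _ ∎
  where open ≡-Reasoning

-- Transfer between alphabets of the same size

data SameRank : List ℕ → List ℕ → ℕ → ℕ → Set where
  top   : ∀ {x x′ v v′} → SameRank (x ∷ v) (x′ ∷ v′) x x′
  below : ∀ {x x′ v v′ a a′} → SameRank v v′ a a′ → SameRank (x ∷ v) (x′ ∷ v′) a a′

SameRank-All : ∀ {P Q : ℕ → Set} {v v′ a a′} → All P v → All Q v′ → SameRank v v′ a a′ → P a × Q a′
SameRank-All (p ∷ _)  (q ∷ _)  top       = p , q
SameRank-All (_ ∷ ps) (_ ∷ qs) (below r) = SameRank-All ps qs r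

-- In a decreasing list the position of a letter is its rank, so comparing letters means comparing
-- positions.
SameRank-iso : ∀ {v v′} → AllPairs _>_ v → AllPairs _>_ v′ → OrderIso (SameRank v v′)
SameRank-iso _ _ {a} {a′} top top =
  trans (dec-false (a <? a) (<-irrefl refl)) (sym (dec-false (a′ <? a′) (<-irrefl refl)))
SameRank-iso (v< ∷ _) (v′< ∷ _) {a} {a′} {b} {b′} top (below s) =
  let b<a , b′<a′ = SameRank-All v< v′< s in
  trans (dec-false (a <? b) (<⇒≯ b<a)) (sym (dec-false (a′ <? b′) (<⇒≯ b′<a′)))
SameRank-iso (v< ∷ _) (v′< ∷ _) {a} {a′} {b} {b′} (below r) top =
  let a<b , a′<b′ = SameRank-All v< v′< r in
  trans (dec-true (a <? b) a<b) (sym (dec-true (a′ <? b′) a′<b′))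
SameRank-iso (_ ∷ d) (_ ∷ d′) (below r) (below s) = SameRank-iso d d′ r s

SameRank-Pointwise : ∀ v v′ → length v ≡ length v′ → Pointwise (SameRank v v′) v v′
SameRank-Pointwise []      []        _   = []
SameRank-Pointwise (x ∷ v) (x′ ∷ v′) len =
  top ∷ Pointwise.map below (SameRank-Pointwise v v′ (suc-injective len))

module _ {R : X → Y → Set} where

  splits-Pointwise : ∀ {w w′} → Pointwise R w w′ →
    Pointwise (λ p q → Pointwise R (proj₁ p) (proj₁ q) × Pointwise R (proj₂ p) (proj₂ q)) (splits w) (splits w′)
  splits-Pointwise []       = ([] , []) ∷ []
  splits-Pointwise (r ∷ rs) =
    ([] , r ∷ rs) ∷ Pointwise.map⁺ _ _ (Pointwise.map (map₁ (r ∷_)) (splits-Pointwise rs))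

  -- `perms` moves letters without inspecting them, so it lists corresponding permutations in the
  -- same order.
  perms-Pointwise : ∀ {v v′} → Pointwise R v v′ → Pointwise (Pointwise R) (perms v) (perms v′)
  perms-Pointwise []       = [] ∷ []
  perms-Pointwise (r ∷ rs) = Pointwise.concat⁺ (Pointwise.map⁺ _ _ (Pointwise.map
    (λ rw → Pointwise.map⁺ _ _ (Pointwise.map (λ (ra , rb) → Pointwise.++⁺ ra (r ∷ rb)) (splits-Pointwise rw)))
    (perms-Pointwise rs)))

-- The permutations counted are those that become uniquely sorted once `j` larger letters are
-- appended. These letters belong to the tail, so the number is `E≥ j (j + n)`, as `E≥-N` shows.
N : ℕ → ℕ → ℕ
N j n = Σ[ perms (D n) ] (λ w → δ 1 (h w j))

Σ-perms-δ-h : ∀ {v} → AllPairs _>_ v → ∀ j → Σ[ perms v ] (λ w → δ 1 (h w j)) ≡ N j (length v)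
Σ-perms-δ-h {v} dec j = Σ-cong-Pointwise
  (λ rw → cong (δ 1) (h-iso (SameRank-iso dec (D-decreasing (length v))) rw j))
  (perms-Pointwise (SameRank-Pointwise v (D (length v)) (sym (length-D (length v)))))

-- Tail length and the position of the largest letter

takeWhile-applyUpTo : ∀ {P : X → Set} {Q : Y → Set} (P? : ∀ x → Dec (P x)) (Q? : ∀ y → Dec (Q y))
  (f : ℕ → X) (g : ℕ → Y) n → (∀ {i} → i < n → does (P? (f i)) ≡ does (Q? (g i))) →
  length (takeWhile P? (applyUpTo f n)) ≡ length (takeWhile Q? (applyUpTo g n))
takeWhile-applyUpTo P? Q? f g zero    eq = refl
takeWhile-applyUpTo P? Q? f g (suc n) eq with does (P? (f 0)) | does (Q? (g 0)) | eq z<s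
... | true  | _ | refl = cong suc (takeWhile-applyUpTo P? Q? (f ∘ suc) (g ∘ suc) n (eq ∘ s<s))
... | false | _ | refl = refl

length-takeWhile-≤ : ∀ {P : X → Set} (P? : ∀ x → Dec (P x)) xs → length (takeWhile P? xs) ≤ length xs
length-takeWhile-≤ P? []       = z≤n
length-takeWhile-≤ P? (x ∷ xs) with does (P? x)
... | true  = s≤s (length-takeWhile-≤ P? xs)
... | false = z≤n

tl-≤ : ∀ w → tl w ≤ length w
tl-≤ w = ≤-trans (length-takeWhile-≤ _ (upTo (length w))) (≤-reflexive (length-upTo (length w)))

!-++ˡ : ∀ a {b k} → k < length a → (a ++ b) ! suc k ≡ a ! suc k
!-++ˡ (x ∷ a) {k = zero}  _     = refl
!-++ˡ (x ∷ a) {k = suc k} k<len = !-++ˡ a (s<s⁻¹ k<len)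

!-last : ∀ a x → (a ∷ʳ x) ! suc (length a) ≡ x
!-last []      x = refl
!-last (y ∷ a) x = !-last a x

!-All : ∀ {P : ℕ → Set} a x b → All P (x ∷ b) → P ((a ++ x ∷ b) ! length (a ++ x ∷ b))
!-All []      x []      (px ∷ _) = px
!-All []      x (y ∷ b) (_ ∷ pb) = !-All [] y b pb
!-All (y ∷ []) x b pb = !-All [] x b pb
!-All (y ∷ z ∷ a) x b pb = !-All (z ∷ a) x b pb

tl-∷ʳ : ∀ {n a} → length a ≡ n → tl (a ∷ʳ suc n) ≡ suc (tl a)
tl-∷ʳ {a = a} refl rewrite ↭.↭-length (↭-sym (↭.∷↭∷ʳ (suc (length a)) a))
  | !-last a (suc (length a)) | dec-true (suc (length a) ≟ suc (length a)) refl =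
  cong suc (takeWhile-applyUpTo _ _ suc id (length a) (λ {i} i<n →
    subst (λ k → does ((a ∷ʳ suc (length a)) ! k ≟ k) ≡ does (a ! k ≟ k)) (sym (+-∸-assoc 1 i<n))
      (cong (λ t → does (t ≟ suc (length a ∸ suc i))) (!-++ˡ a (∸-monoʳ-< {length a} z<s i<n)))))

tl-≢ : ∀ w → w ! length w ≢ length w → tl w ≡ 0
tl-≢ [] ne = refl
tl-≢ (x ∷ w) ne rewrite dec-false ((x ∷ w) ! suc (length w) ≟ suc (length w)) ne = refl

tl-0 : ∀ {n a b₀ b} → length (a ++ b₀ ∷ b) ≡ n → All (_< suc n) (b₀ ∷ b) → tl (a ++ suc n ∷ b₀ ∷ b) ≡ 0
-- The word has length `suc n`, but its last letter lies in `b₀ ∷ b` and is therefore smaller, so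
-- the very first test of the tail fails.
tl-0 {n} {a} {b₀} {b} len b<n = tl-≢ w (<⇒≢ (subst (w ! length w <_) (sym len-w)
    (subst (λ l → l ! length l < suc n) (++-assoc a (suc n ∷ []) (b₀ ∷ b)) (!-All (a ∷ʳ suc n) b₀ b b<n))))
  where
  w : List ℕ
  w = a ++ suc n ∷ b₀ ∷ b
  len-w : length w ≡ suc n
  len-w = trans (↭.↭-length (↭.shift (suc n) a (b₀ ∷ b))) (cong suc len)

-- Decreasing trees and preimages under the stack-sorting map

data Tree : Set where
  leaf : Tree
  node : Tree → ℕ → Tree → Tree

inorder postorder : Tree → List ℕ
inorder leaf           = []
inorder (node l x r)   = inorder l ++ x ∷ inorder r
postorder leaf         = []
postorder (node l x r) = postorder l ++ postorder r ++ x ∷ []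

_≺_ : Tree → ℕ → Set
leaf       ≺ x = ⊤
node _ y _ ≺ x = y < x

data Decreasing : Tree → Set where
  leaf : Decreasing leaf
  node : ∀ {l x r} → l ≺ x → r ≺ x → Decreasing l → Decreasing r → Decreasing (node l x r)

≺-trans : ∀ t {x y} → t ≺ x → x < y → t ≺ y
≺-trans leaf         _   _   = tt
≺-trans (node _ _ _) t<x x<y = <-trans t<x x<y

inorder-< : ∀ {t x} → Decreasing t → t ≺ x → All (_< x) (inorder t)
inorder-< leaf _ = []
inorder-< {node l y r} (node l<y r<y dl dr) y<x =
  All.++⁺ (inorder-< dl (≺-trans l l<y y<x)) (y<x ∷ inorder-< dr (≺-trans r r<y y<x))

inorder-↭-postorder : ∀ t → inorder t ↭ postorder t
inorder-↭-postorder leaf         = ↭-refl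
inorder-↭-postorder (node l x r) = ↭.++⁺ (inorder-↭-postorder l)
  (↭-trans (prep x (inorder-↭-postorder r)) (↭.∷↭∷ʳ x (postorder r)))

-- The new first letter of the inorder reading walks down the left spine past all roots that are not
-- smaller, and takes the remaining subtree as its right child. On words without repetition,
-- iterating this inverts `inorder`.
cons : ℕ → Tree → Tree
cons x leaf         = node leaf x leaf
cons x (node l y r) = if does (y <? x) then node leaf x (node l y r) else node (cons x l) y r

fromInorder : List ℕ → Tree
fromInorder = foldr cons leaf

inorder-cons : ∀ x t → inorder (cons x t) ≡ x ∷ inorder t
inorder-cons x leaf = refl
inorder-cons x (node l y r) with does (y <? x)
... | true  = refl
... | false = cong (_++ y ∷ inorder r) (inorder-cons x l)

inorder-fromInorder : ∀ w → inorder (fromInorder w) ≡ w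
inorder-fromInorder []      = refl
inorder-fromInorder (x ∷ w) =
  trans (inorder-cons x (fromInorder w)) (cong (x ∷_) (inorder-fromInorder w))

cons-≺ : ∀ {x y} t → x < y → t ≺ y → cons x t ≺ y
cons-≺ leaf x<y _ = x<y
cons-≺ {x} (node l z r) x<y z<y with does (z <? x)
... | true  = x<y
... | false = z<y

cons-Decreasing : ∀ {x t} → All (x ≢_) (inorder t) → Decreasing t → Decreasing (cons x t)
cons-Decreasing _ leaf = node tt tt leaf leaf
cons-Decreasing {x} {node l y r} x∉ d@(node l<y r<y dl dr) with y <? x | All.++⁻ (inorder l) x∉
... | yes y<x | _ rewrite dec-true (y <? x) y<x = node tt y<x leaf d
... | no y≮x | x∉l , x≢y ∷ _ rewrite dec-false (y <? x) y≮x =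
  node (cons-≺ l (≤∧≢⇒< (≮⇒≥ y≮x) x≢y) l<y) r<y (cons-Decreasing x∉l dl) dr

fromInorder-Decreasing : ∀ {w} → Unique w → Decreasing (fromInorder w)
fromInorder-Decreasing [] = leaf
fromInorder-Decreasing {x ∷ w} (x∉ ∷ u) =
  cons-Decreasing (subst (All (x ≢_)) (sym (inorder-fromInorder w)) x∉) (fromInorder-Decreasing u)

cons-max : ∀ {x} t → t ≺ x → cons x t ≡ node leaf x t
cons-max leaf _ = refl
cons-max {x} (node l y r) y<x rewrite dec-true (y <? x) y<x = refl

foldr-cons-node : ∀ {x} w l r → All (_< x) w →
  foldr cons (node l x r) w ≡ node (foldr cons l w) x r
foldr-cons-node []      l r [] = refl
foldr-cons-node {x} (y ∷ w) l r (y<x ∷ w<x)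
  rewrite foldr-cons-node w l r w<x | dec-false (x <? y) (<⇒≯ y<x) = refl

fromInorder-inorder : ∀ {t} → Decreasing t → fromInorder (inorder t) ≡ t
fromInorder-inorder leaf = refl
fromInorder-inorder {node l x r} (node l<x r<x dl dr) = begin
  foldr cons leaf (inorder l ++ x ∷ inorder r)
    ≡⟨ foldr-++ cons leaf (inorder l) (x ∷ inorder r) ⟩
  foldr cons (cons x (fromInorder (inorder r))) (inorder l)
    ≡⟨ cong (λ t → foldr cons (cons x t) (inorder l)) (fromInorder-inorder dr) ⟩
  foldr cons (cons x r) (inorder l)
    ≡⟨ cong (λ t → foldr cons t (inorder l)) (cons-max r r<x) ⟩
  foldr cons (node leaf x r) (inorder l)
    ≡⟨ foldr-cons-node (inorder l) leaf r (inorder-< dl l<x) ⟩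
  node (fromInorder (inorder l)) x r
    ≡⟨ cong (λ t → node t x r) (fromInorder-inorder dl) ⟩
  node l x r ∎
  where open ≡-Reasoning

-- The stack-sorting map on inorder readings

_≺head_ : Tree → List ℕ → Set
t ≺head []      = ⊤
t ≺head (x ∷ _) = t ≺ x

run-push : ∀ {x} t {l r} ι → node l x r ≺head t → run (x ∷ ι) t ≡ run ι (x ∷ t)
run-push []      ι _   = refl
run-push {x} (t ∷ σ) ι x<t rewrite dec-true (x <? t) x<t = refl

run-pop : ∀ {l x r} ι σ → node l x r ≺head ι → run ι (x ∷ σ) ≡ x ∷ run ι σ
run-pop []      σ _   = refl
run-pop {x = x} (y ∷ ι) σ x<y rewrite dec-false (y <? x) (<⇒≯ x<y) = refl

-- The left subtree is sorted and flushed by the arrival of `x`; then `x` waits on the stack, below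
-- the right subtree, until the next larger input letter or the end of the input. The two `≺head`
-- conditions say that the old stack never blocks a push and that the next input flushes the whole
-- tree.
run-inorder : ∀ {t} → Decreasing t → ∀ ι σ → t ≺head σ → t ≺head ι →
  run (inorder t ++ ι) σ ≡ postorder t ++ run ι σ
run-inorder leaf ι σ _ _ = refl
run-inorder {node l x r} (node l<x r<x dl dr) ι σ x<σ x<ι = begin
  run ((inorder l ++ x ∷ inorder r) ++ ι) σ
    ≡⟨ cong (λ w → run w σ) (++-assoc (inorder l) (x ∷ inorder r) ι) ⟩
  run (inorder l ++ x ∷ inorder r ++ ι) σ
    ≡⟨ run-inorder dl (x ∷ inorder r ++ ι) σ (up l l<x σ x<σ) l<x ⟩
  postorder l ++ run (x ∷ inorder r ++ ι) σ
    ≡⟨ cong (postorder l ++_) (run-push {x} σ {l} {r} (inorder r ++ ι) x<σ) ⟩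
  postorder l ++ run (inorder r ++ ι) (x ∷ σ)
    ≡⟨ cong (postorder l ++_) (run-inorder dr ι (x ∷ σ) r<x (up r r<x ι x<ι)) ⟩
  postorder l ++ postorder r ++ run ι (x ∷ σ)
    ≡⟨ cong (λ w → postorder l ++ postorder r ++ w) (run-pop {l} {x} {r} ι σ x<ι) ⟩
  postorder l ++ postorder r ++ x ∷ run ι σ
    ≡⟨ cong (postorder l ++_) (++-assoc (postorder r) (x ∷ []) (run ι σ)) ⟨
  postorder l ++ (postorder r ++ x ∷ []) ++ run ι σ
    ≡⟨ ++-assoc (postorder l) (postorder r ++ x ∷ []) (run ι σ) ⟨
  (postorder l ++ postorder r ++ x ∷ []) ++ run ι σ ∎
  where
  open ≡-Reasoning
  up : ∀ t → t ≺ x → ∀ w → node l x r ≺head w → t ≺head w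
  up t t<x []      _   = tt
  up t t<x (y ∷ w) x<y = ≺-trans t t<x x<y

s-inorder : ∀ {t} → Decreasing t → s (inorder t) ≡ postorder t
s-inorder {t} d = begin
  run (inorder t) []        ≡⟨ cong (λ w → run w []) (++-identityʳ (inorder t)) ⟨
  run (inorder t ++ []) []  ≡⟨ run-inorder d [] [] tt tt ⟩
  postorder t ++ []         ≡⟨ ++-identityʳ (postorder t) ⟩
  postorder t               ∎
  where open ≡-Reasoning

-- Parsing with whole trees on the stack

root : Tree → ℕ
-- A default value: the stacks that arise in parsing contain only nodes.
root leaf         = 0
root (node _ x _) = x

joinTwoᵗ : ℕ → Tree → List Tree → List (List Tree)
joinTwoᵗ x t []      = []
joinTwoᵗ x t (u ∷ φ) = if does (root u <? x) then (node u x t ∷ φ) ∷ [] else []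

stepsᵗ : ℕ → List Tree → List (List Tree)
stepsᵗ x []      = (node leaf x leaf ∷ []) ∷ []
stepsᵗ x (t ∷ φ) = (node leaf x leaf ∷ t ∷ φ) ∷
  (if does (root t <? x) then (node t x leaf ∷ φ) ∷ (node leaf x t ∷ φ) ∷ joinTwoᵗ x t φ else [])

endsᵗ : List Tree → List ℕ → List (List Tree)
endsᵗ φ []      = φ ∷ []
endsᵗ φ (x ∷ w) = concatMap (λ ψ → endsᵗ ψ w) (stepsᵗ x φ)

roots-stepsᵗ : ∀ x φ → map (map root) (stepsᵗ x φ) ≡ steps x (map root φ)
roots-stepsᵗ x [] = refl
roots-stepsᵗ x (t ∷ φ) with does (root t <? x)
... | false = refl
... | true  = cong (λ l → (x ∷ root t ∷ map root φ) ∷ (x ∷ map root φ) ∷ (x ∷ map root φ) ∷ l) (two φ)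
  where
  two : ∀ φ → map (map root) (joinTwoᵗ x t φ) ≡ joinTwo x (map root φ)
  two [] = refl
  two (u ∷ φ) with does (root u <? x)
  ... | false = refl
  ... | true  = refl

Σ-endsᵗ : ∀ (f : List ℕ → ℕ) w φ → Σ[ endsᵗ φ w ] (f ∘ map root) ≡ Σ[ ends (map root φ) w ] f
Σ-endsᵗ f []      φ = refl
Σ-endsᵗ f (x ∷ w) φ = begin
  Σ[ concatMap (λ ψ → endsᵗ ψ w) (stepsᵗ x φ) ] (f ∘ map root)
    ≡⟨ Σ-concatMap _ _ (stepsᵗ x φ) ⟩
  Σ[ stepsᵗ x φ ] (λ ψ → Σ[ endsᵗ ψ w ] (f ∘ map root))
    ≡⟨ Σ-cong (Σ-endsᵗ f w) (stepsᵗ x φ) ⟩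
  Σ[ stepsᵗ x φ ] (λ ψ → Σ[ ends (map root ψ) w ] f)
    ≡⟨ Σ-map (map root) _ (stepsᵗ x φ) ⟨
  Σ[ map (map root) (stepsᵗ x φ) ] (λ τ → Σ[ ends τ w ] f)
    ≡⟨ cong (λ l → Σ[ l ] (λ τ → Σ[ ends τ w ] f)) (roots-stepsᵗ x φ) ⟩
  Σ[ steps x (map root φ) ] (λ τ → Σ[ ends τ w ] f)
    ≡⟨ Σ-concatMap _ f (steps x (map root φ)) ⟨
  Σ[ concatMap (λ τ → ends τ w) (steps x (map root φ)) ] f ∎
  where open ≡-Reasoning

push : Tree → List Tree → List Tree
push leaf           φ = φ
push t@(node _ _ _) φ = t ∷ φ

-- Since `push` leaves no trace of an empty subtree, this one rule covers all four kinds of entries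
-- of `stepsᵗ`. The right subtree is read later and so lies above the left one.
data Step : List Tree → ℕ → List Tree → Set where
  step : ∀ {l x r φ} → l ≺ x → r ≺ x → Step (push r (push l φ)) x (node l x r ∷ φ)

data IsNode : Tree → Set where
  node : ∀ {l x r} → IsNode (node l x r)

stepsᵗ-sound : ∀ {x φ} → All IsNode φ → All (Step φ x) (stepsᵗ x φ)
stepsᵗ-sound [] = step tt tt ∷ []
stepsᵗ-sound {x} {t@(node _ y _) ∷ φ} (node ∷ nφ) with y <? x
... | no  t≮x rewrite dec-false (y <? x) t≮x = step tt tt ∷ []
... | yes t<x rewrite dec-true (y <? x) t<x = step tt tt ∷ step t<x tt ∷ step tt t<x ∷ two nφ
  where
  two : ∀ {φ} → All IsNode φ → All (Step (t ∷ φ) x) (joinTwoᵗ x t φ)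
  two [] = []
  two {node _ z _ ∷ φ} (node ∷ _) with z <? x
  ... | no  u≮x rewrite dec-false (z <? x) u≮x = []
  ... | yes u<x rewrite dec-true (z <? x) u<x = step u<x t<x ∷ []

stepsᵗ-complete : ∀ {x φ ψ} → Step φ x ψ → ψ ∈ stepsᵗ x φ
stepsᵗ-complete (step {leaf} {x} {leaf} {[]} _ _)    = here refl
stepsᵗ-complete (step {leaf} {x} {leaf} {_ ∷ _} _ _) = here refl
stepsᵗ-complete (step {node _ y _} {x} {leaf} y<x _)
  rewrite dec-true (y <? x) y<x = there (here refl)
stepsᵗ-complete (step {leaf} {x} {node _ z _} _ z<x)
  rewrite dec-true (z <? x) z<x = there (there (here refl))
stepsᵗ-complete (step {node _ y _} {x} {node _ z _} y<x z<x)
  rewrite dec-true (z <? x) z<x | dec-true (y <? x) y<x = there (there (there (here refl)))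

push-nodes⁻ : ∀ t {φ} → All IsNode (push t φ) → All IsNode φ
push-nodes⁻ leaf         nφ       = nφ
push-nodes⁻ (node _ _ _) (_ ∷ nφ) = nφ

step-nodes : ∀ {φ x ψ} → Step φ x ψ → All IsNode φ → All IsNode ψ
step-nodes (step {l} {r = r} _ _) nφ = node ∷ push-nodes⁻ l (push-nodes⁻ r nφ)

-- Every step can be undone without knowing which letter was read, so distinct
-- sequences of steps end in distinct stacks.
undo : List Tree → List Tree
undo []               = []
undo (leaf ∷ φ)       = φ
undo (node l x r ∷ φ) = push r (push l φ)

undo-step : ∀ {φ x ψ} → Step φ x ψ → undo ψ ≡ φ
undo-step (step _ _) = refl

unwind : List ℕ → List Tree → List Tree
unwind []      ψ = ψ
unwind (_ ∷ w) ψ = undo (unwind w ψ)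

unwind-endsᵗ : ∀ w {φ} → All IsNode φ → All (λ ψ → unwind w ψ ≡ φ) (endsᵗ φ w)
unwind-endsᵗ []      nφ = refl ∷ []
unwind-endsᵗ (x ∷ w) nφ = All-concatMap (All.map
  (λ st → All.map (λ eq → trans (cong undo eq) (undo-step st)) (unwind-endsᵗ w (step-nodes st nφ)))
  (stepsᵗ-sound nφ))

Unique-stepsᵗ : ∀ x {φ} → All IsNode φ → Unique (stepsᵗ x φ)
Unique-stepsᵗ x [] = [] ∷ []
Unique-stepsᵗ x {node _ y _ ∷ φ} (node ∷ nφ) with does (y <? x)
... | false = [] ∷ []
... | true with nφ
...   | [] = ((λ ()) ∷ (λ ()) ∷ []) ∷ ((λ ()) ∷ []) ∷ [] ∷ []
...   | node {_} {z} ∷ _ with does (z <? x)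
...     | false = ((λ ()) ∷ (λ ()) ∷ []) ∷ ((λ ()) ∷ []) ∷ [] ∷ []
...     | true  = ((λ ()) ∷ (λ ()) ∷ (λ ()) ∷ []) ∷ ((λ ()) ∷ (λ ()) ∷ []) ∷ ((λ ()) ∷ []) ∷ [] ∷ []

stepsᵗ-nodes : ∀ {x φ} → All IsNode φ → All (All IsNode) (stepsᵗ x φ)
stepsᵗ-nodes nφ = All.map (λ st → step-nodes st nφ) (stepsᵗ-sound nφ)

Unique-endsᵗ : ∀ w {φ} → All IsNode φ → Unique (endsᵗ φ w)
Unique-endsᵗ []      nφ = [] ∷ []
Unique-endsᵗ (x ∷ w) nφ = Unique-concatMap same
  (All.map (Unique-endsᵗ w) (stepsᵗ-nodes nφ)) (Unique-stepsᵗ x nφ)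
  where
  same : ∀ {φ ψ χ} → φ ∈ stepsᵗ x _ → ψ ∈ stepsᵗ x _ → χ ∈ endsᵗ φ w → χ ∈ endsᵗ ψ w → φ ≡ ψ
  same φ∈ ψ∈ χ∈φ χ∈ψ = trans
    (sym (All.lookup (unwind-endsᵗ w (All.lookup (stepsᵗ-nodes nφ) φ∈)) χ∈φ))
    (All.lookup (unwind-endsᵗ w (All.lookup (stepsᵗ-nodes nφ) ψ∈)) χ∈ψ)

endsᵗ-nodes : ∀ w {φ} → All IsNode φ → All (All IsNode) (endsᵗ φ w)
endsᵗ-nodes []      nφ = nφ ∷ []
endsᵗ-nodes (x ∷ w) nφ = All-concatMap (All.map (endsᵗ-nodes w) (stepsᵗ-nodes nφ))

postorders : List Tree → List ℕ
postorders []      = []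
postorders (t ∷ φ) = postorders φ ++ postorder t

postorders-push : ∀ t φ → postorders (push t φ) ≡ postorders φ ++ postorder t
postorders-push leaf         φ = sym (++-identityʳ (postorders φ))
postorders-push (node _ _ _) φ = refl

step-postorders : ∀ {φ x ψ} → Step φ x ψ → postorders ψ ≡ postorders φ ++ x ∷ []
step-postorders (step {l} {x} {r} {φ} _ _) = begin
  postorders φ ++ postorder l ++ postorder r ++ x ∷ []
    ≡⟨ ++-assoc (postorders φ) (postorder l) _ ⟨
  (postorders φ ++ postorder l) ++ postorder r ++ x ∷ []
    ≡⟨ ++-assoc (postorders φ ++ postorder l) (postorder r) (x ∷ []) ⟨
  ((postorders φ ++ postorder l) ++ postorder r) ++ x ∷ []
    ≡⟨ cong (λ w → (w ++ postorder r) ++ x ∷ []) (postorders-push l φ) ⟨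
  (postorders (push l φ) ++ postorder r) ++ x ∷ []
    ≡⟨ cong (_++ x ∷ []) (postorders-push r (push l φ)) ⟨
  postorders (push r (push l φ)) ++ x ∷ [] ∎
  where open ≡-Reasoning

push-Decreasing⁻ : ∀ t {φ} → All Decreasing (push t φ) → Decreasing t × All Decreasing φ
push-Decreasing⁻ leaf         dφ       = leaf , dφ
push-Decreasing⁻ (node _ _ _) (d ∷ dφ) = d , dφ

step-Decreasing : ∀ {φ x ψ} → Step φ x ψ → All Decreasing φ → All Decreasing ψ
step-Decreasing (step {l} {r = r} l<x r<x) d =
  let dr , d′ = push-Decreasing⁻ r d
      dl , dφ = push-Decreasing⁻ l d′
  in node l<x r<x dl dr ∷ dφ

endsᵗ-sound : ∀ w {φ} → All IsNode φ → All Decreasing φ →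
  All (λ ψ → postorders ψ ≡ postorders φ ++ w × All Decreasing ψ) (endsᵗ φ w)
endsᵗ-sound []      {φ} nφ dφ = (sym (++-identityʳ (postorders φ)) , dφ) ∷ []
endsᵗ-sound (x ∷ w) {φ} nφ dφ = All-concatMap (All.map each (stepsᵗ-sound nφ))
  where
  each : ∀ {ψ} → Step φ x ψ → All (λ χ → postorders χ ≡ postorders φ ++ x ∷ w × All Decreasing χ) (endsᵗ ψ w)
  each st = All.map (map₁ (λ eq → trans eq (trans (cong (_++ w) (step-postorders st)) (++-assoc (postorders φ) (x ∷ []) w))))
    (endsᵗ-sound w (step-nodes st nφ) (step-Decreasing st dφ))

-- The parse that rebuilds `t` is followed backwards. Carrying an arbitrary remaining word `w` lets
-- the hypotheses for both subtrees be chained before the final step at the root.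
endsᵗ-complete : ∀ {t} → Decreasing t → ∀ {w φ ψ} → ψ ∈ endsᵗ (push t φ) w → ψ ∈ endsᵗ φ (postorder t ++ w)
endsᵗ-complete leaf ψ∈ = ψ∈
endsᵗ-complete {node l x r} (node l<x r<x dl dr) {w} {φ} {ψ} ψ∈ =
  subst (λ v → ψ ∈ endsᵗ φ v) (sym eq)
    (endsᵗ-complete dl (endsᵗ-complete dr (∈-concatMap (stepsᵗ-complete (step l<x r<x)) ψ∈)))
  where
  eq : (postorder l ++ postorder r ++ x ∷ []) ++ w ≡ postorder l ++ postorder r ++ x ∷ w
  eq = trans (++-assoc (postorder l) _ w) (cong (postorder l ++_) (++-assoc (postorder r) (x ∷ []) w))

single : List Tree → List Tree
-- An empty stack comes from the empty word, whose tree is `leaf`; this is the case `c 0 0 = 1`.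
single []          = leaf ∷ []
single (t ∷ [])    = t ∷ []
single (_ ∷ _ ∷ _) = []

treesOf : List ℕ → List Tree
treesOf w = concatMap single (endsᵗ [] w)

length-single : ∀ φ → length (single φ) ≡ c 0 (length (map root φ))
length-single []          = refl
length-single (_ ∷ [])    = refl
length-single (_ ∷ _ ∷ _) = refl

length-Σ : ∀ (xs : List X) → length xs ≡ Σ[ xs ] (λ _ → 1)
length-Σ []       = refl
length-Σ (x ∷ xs) = cong suc (length-Σ xs)

length-treesOf : ∀ w → length (treesOf w) ≡ h w 0
length-treesOf w = begin
  length (treesOf w)                                 ≡⟨ length-Σ (treesOf w) ⟩
  Σ[ concatMap single (endsᵗ [] w) ] (λ _ → 1)       ≡⟨ Σ-concatMap single _ (endsᵗ [] w) ⟩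
  Σ[ endsᵗ [] w ] (λ φ → Σ[ single φ ] (λ _ → 1))
    ≡⟨ Σ-cong (λ φ → trans (sym (length-Σ (single φ))) (length-single φ)) (endsᵗ [] w) ⟩
  Σ[ endsᵗ [] w ] (c 0 ∘ length ∘ map root)          ≡⟨ Σ-endsᵗ (c 0 ∘ length) w [] ⟩
  h w 0                                              ∎
  where open ≡-Reasoning

∈-single : ∀ t → t ∈ single (push t [])
∈-single leaf         = here refl
∈-single (node _ _ _) = here refl

single-push : ∀ {φ t} → All IsNode φ → t ∈ single φ → φ ≡ push t []
single-push []          (here refl) = refl
single-push (node ∷ []) (here refl) = refl

Unique-treesOf : ∀ w → Unique (treesOf w)
Unique-treesOf w = Unique-concatMap
  (λ φ∈ ψ∈ t∈φ t∈ψ → trans (single-push (All.lookup (endsᵗ-nodes w []) φ∈) t∈φ)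
                            (sym (single-push (All.lookup (endsᵗ-nodes w []) ψ∈) t∈ψ)))
  (All.universal (λ { [] → [] ∷ [] ; (_ ∷ []) → [] ∷ [] ; (_ ∷ _ ∷ _) → [] }) (endsᵗ [] w))
  (Unique-endsᵗ w [])

treesOf-sound : ∀ w {t} → t ∈ treesOf w → Decreasing t × postorder t ≡ w
treesOf-sound w {t} t∈ with ∈-concat⁻′ (map single (endsᵗ [] w)) t∈
... | _ , t∈s , s∈ with ∈-map⁻ single s∈
... | φ , φ∈ , refl with single-push (All.lookup (endsᵗ-nodes w []) φ∈) t∈s
                       | All.lookup (endsᵗ-sound w [] []) φ∈
...   | refl | eq , d = proj₁ (push-Decreasing⁻ t d) , trans (sym (postorders-push t [])) eq

treesOf-complete : ∀ {t} → Decreasing t → t ∈ treesOf (postorder t)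
treesOf-complete {t} d = ∈-concatMap
  (subst (λ w → push t [] ∈ endsᵗ [] w) (++-identityʳ (postorder t)) (endsᵗ-complete d {[]} {[]} (here refl)))
  (∈-single t)

-- By `s-inorder`, `inorder` sends the decreasing trees with postorder `w` to preimages of `w`;
-- `fromInorder` recovers the tree of each preimage.
length-preimage : ∀ {n w} → w ∈ S n → length (preimage n w) ≡ h w 0
length-preimage {n} {w} w∈S = begin
  length (preimage n w)
    ≡⟨ ↭.↭-length (unique∧set⇒↭ (Unique.filter⁺ _ (Unique-S n))
         (Unique-map (λ t∈ u∈ → inorder-injective (proj₁ (treesOf-sound w t∈)) (proj₁ (treesOf-sound w u∈))) (Unique-treesOf w))
         pre⊆ ⊆pre) ⟩
  length (map inorder (treesOf w))
    ≡⟨ length-map inorder (treesOf w) ⟩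
  length (treesOf w)
    ≡⟨ length-treesOf w ⟩
  h w 0 ∎
  where
  open ≡-Reasoning
  inorder-injective : ∀ {t u} → Decreasing t → Decreasing u → inorder t ≡ inorder u → t ≡ u
  inorder-injective dt du eq =
    trans (sym (fromInorder-inorder dt)) (trans (cong fromInorder eq) (fromInorder-inorder du))
  pre⊆ : ∀ {v} → v ∈ preimage n w → v ∈ map inorder (treesOf w)
  pre⊆ {v} v∈ with ∈-filter⁻ (λ σ → ≡-dec _≟_ (s σ) w) {xs = S n} v∈
  ... | v∈S , sv≡w = subst (_∈ map inorder (treesOf w)) (inorder-fromInorder v)
    (∈-map⁺ inorder (subst (λ u → t ∈ treesOf u) post (treesOf-complete d)))
    where
    t : Tree
    t = fromInorder v
    d : Decreasing t
    d = fromInorder-Decreasing (proj₂ (∈-filter⁻ unique? {xs = words n [ 1 ⋯ n ]} v∈S))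
    post : postorder t ≡ w
    post = trans (sym (s-inorder d)) (trans (cong s (inorder-fromInorder v)) sv≡w)
  ⊆pre : ∀ {v} → v ∈ map inorder (treesOf w) → v ∈ preimage n w
  ⊆pre v∈ with ∈-map⁻ inorder v∈
  ... | t , t∈ , refl with treesOf-sound w t∈
  ...   | d , post = ∈-filter⁺ (λ σ → ≡-dec _≟_ (s σ) w)
    (↭⇒∈S (↭-trans (inorder-↭-postorder t) (subst (_↭ [ 1 ⋯ n ]) (sym post) (∈S⇒↭ w∈S))))
    (trans (s-inorder d) post)

-- The recurrence

E-Σ : ∀ m n → E m n ≡ Σ[ perms (D n) ] (λ w → δ (tl w) m * δ 1 (h w 0))
E-Σ m n = begin
  E m n
    ≡⟨ length-filter-Σ (counted? m n) ι one zer (S n) ⟩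
  Σ[ S n ] ι
    ≡⟨ Σ-cong-All {xs = S n} (All.tabulate (λ {w} w∈ → cong (λ t → δ (tl w) m * δ 1 t) (length-preimage {n} {w} w∈))) ⟩
  Σ[ S n ] (λ w → δ (tl w) m * δ 1 (h w 0))
    ≡⟨ Σ-↭ _ (S-↭-perms n) ⟩
  Σ[ perms (D n) ] (λ w → δ (tl w) m * δ 1 (h w 0)) ∎
  where
  open ≡-Reasoning
  ι : List ℕ → ℕ
  ι w = δ (tl w) m * δ 1 (length (preimage n w))
  one : ∀ w → UniquelySorted n w × tl w ≡ m → ι w ≡ 1
  one w (us , refl) rewrite us = cong (_* 1) (δ-refl (tl w))
  zer : ∀ w → ¬ (UniquelySorted n w × tl w ≡ m) → ι w ≡ 0
  zer w ¬p with tl w ≟ m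
  ... | no tl≢m = cong (_* δ 1 (length (preimage n w))) (δ-≢ tl≢m)
  ... | yes tl≡m = trans (cong (δ (tl w) m *_) (δ-≢ (λ eq → ¬p (sym eq , tl≡m)))) (*-zeroʳ (δ (tl w) m))

D-perm-< : ∀ {n w} → w ↭ D n → All (_< suc n) w
D-perm-< {n} w↭ = ↭.All-resp-↭ (↭-sym w↭) (D-< n)

D-perm-length : ∀ {n w} → w ↭ D n → length w ≡ n
D-perm-length {n} w↭ = trans (↭.↭-length w↭) (length-D n)

-- A positive tail length puts the largest letter at the end; every other place for it gives tail
-- length 0 and no contribution. Once removed, it is one more of the larger letters counted by `h`.
Σ-tail-suc : ∀ n l j →
  Σ[ perms (D (suc n)) ] (λ w → δ (tl w) (suc l) * δ 1 (h w j)) ≡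
  Σ[ perms (D n) ] (λ w → δ (tl w) l * δ 1 (h w (suc j)))
Σ-tail-suc n l j = trans (Σ-perms-∷ f (suc n) (D n)) (Σ-cong-All (All.map each (perms-↭ (D n))))
  where
  f : List ℕ → ℕ
  f w = δ (tl w) (suc l) * δ 1 (h w j)
  each : ∀ {w} → w ↭ D n → Σ[ splits w ] (f ∘ insert (suc n)) ≡ δ (tl w) l * δ 1 (h w (suc j))
  each {w} w↭ = trans (Σ-splits-last w (f ∘ insert (suc n)) zer)
    (cong₂ (λ t u → δ t (suc l) * δ 1 u) (tl-∷ʳ {a = w} (D-perm-length w↭)) (h-∷ʳ (D-perm-< w↭) j))
    where
    zer : ∀ a b₀ b → a ++ b₀ ∷ b ≡ w → f (a ++ suc n ∷ b₀ ∷ b) ≡ 0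
    zer a b₀ b refl = cong (λ t → δ t (suc l) * δ 1 (h (a ++ suc n ∷ b₀ ∷ b) j))
      (tl-0 {a = a} (D-perm-length w↭) (All.++⁻ʳ a (D-perm-< w↭)))

Σ-tail-+ : ∀ m n l j →
  Σ[ perms (D (m + n)) ] (λ w → δ (tl w) (m + l) * δ 1 (h w j)) ≡
  Σ[ perms (D n) ] (λ w → δ (tl w) l * δ 1 (h w (m + j)))
Σ-tail-+ zero    n l j = refl
Σ-tail-+ (suc m) n l j = trans (Σ-tail-suc (m + n) (m + l) j) (trans (Σ-tail-+ m n l (suc j))
  (Σ-cong (λ w → cong (λ i → δ (tl w) l * δ 1 (h w i)) (+-suc m j)) (perms (D n))))

E-tail : ∀ m n l → E (m + l) (m + n) ≡ Σ[ perms (D n) ] (λ w → δ (tl w) l * δ 1 (h w m))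
E-tail m n l = trans (E-Σ (m + l) (m + n)) (trans (Σ-tail-+ m n l 0)
  (Σ-cong (λ w → cong (λ i → δ (tl w) l * δ 1 (h w i)) (+-identityʳ m)) (perms (D n))))

-- After removal of `m` tail letters, each word has exactly one tail length between 0 and `n`, so
-- summing over `l` erases the condition on the tail.
E≥-N : ∀ m n → E≥ m (m + n) ≡ N m n
E≥-N m n = begin
  Σ[ applyUpTo (m +_) (suc (m + n) ∸ m) ] (λ l → E l (m + n))
    ≡⟨ cong (λ k → Σ[ applyUpTo (m +_) k ] (λ l → E l (m + n)))
         (trans (cong (_∸ m) (sym (+-suc m n))) (m+n∸m≡n m (suc n))) ⟩
  Σ[ applyUpTo (m +_) (suc n) ] (λ l → E l (m + n))
    ≡⟨ Σ-applyUpTo-cong {g = id} (suc n) (λ {l} _ → E-tail m n l) ⟩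
  Σ[ upTo (suc n) ] (λ l → Σ[ perms (D n) ] (λ w → δ (tl w) l * δ 1 (h w m)))
    ≡⟨ Σ-swap _ (upTo (suc n)) (perms (D n)) ⟩
  Σ[ perms (D n) ] (λ w → Σ[ upTo (suc n) ] (λ l → δ (tl w) l * δ 1 (h w m)))
    ≡⟨ Σ-cong-All (All.map each (perms-↭ (D n))) ⟩
  N m n ∎
  where
  open ≡-Reasoning
  each : ∀ {w} → w ↭ D n → Σ[ upTo (suc n) ] (λ l → δ (tl w) l * δ 1 (h w m)) ≡ δ 1 (h w m)
  each {w} w↭ = begin
    Σ[ upTo (suc n) ] (λ l → δ (tl w) l * δ 1 (h w m))
      ≡⟨ Σ-*ʳ (δ 1 (h w m)) (δ (tl w)) (upTo (suc n)) ⟩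
    Σ[ upTo (suc n) ] (δ (tl w)) * δ 1 (h w m)
      ≡⟨ cong (_* δ 1 (h w m)) (Σ-δ (suc n) (s≤s (≤-trans (tl-≤ w) (≤-reflexive (D-perm-length w↭))))) ⟩
    1 * δ 1 (h w m)
      ≡⟨ *-identityˡ (δ 1 (h w m)) ⟩
    δ 1 (h w m) ∎

-- The value 0 on the empty word encodes that `B` must be nonempty, and `N⁺` inherits it.
δh⁺ : List ℕ → ℕ → ℕ
δh⁺ []      j = 0
δh⁺ (x ∷ w) j = δ 1 (h (x ∷ w) j)

N⁺ : ℕ → ℕ → ℕ
N⁺ j zero    = 0
N⁺ j (suc n) = N j (suc n)

N⁺-N : ∀ j {n} → 0 < n → N⁺ j n ≡ N j n
N⁺-N j {suc n} _ = refl

Σ-perms-δh⁺ : ∀ {v} → AllPairs _>_ v → ∀ j → Σ[ perms v ] (λ w → δh⁺ w j) ≡ N⁺ j (length v)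
Σ-perms-δh⁺ {[]}    _   j = refl
Σ-perms-δh⁺ {x ∷ v} dec j = trans (Σ-cong-All (All.map (λ {w} → each w ∘ ↭.↭-length) (perms-↭ (x ∷ v)))) (Σ-perms-δ-h dec j)
  where
  each : ∀ w → length w ≡ suc (length v) → δh⁺ w j ≡ δ 1 (h w j)
  each (_ ∷ _) _ = refl

conv-zero : ∀ a m → conv a (λ _ → 0) m ≡ 0
conv-zero a m = conv-zeroʳ a (λ _ → 0) m (λ _ → refl)

E-splits : ∀ m k → E m (m + suc k) ≡
  Σ[ perms (D k) ] (λ w → Σ[ splits w ] (λ (a , b) → conv (δ 1 ∘ h a ∘ suc) (δh⁺ b) m))
E-splits m k = begin
  E m (m + suc k)
    ≡⟨ cong (λ l → E l (m + suc k)) (+-identityʳ m) ⟨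
  E (m + 0) (m + suc k)
    ≡⟨ E-tail m (suc k) 0 ⟩
  Σ[ perms (D (suc k)) ] f
    ≡⟨ Σ-perms-∷ f (suc k) (D k) ⟩
  Σ[ perms (D k) ] (λ w → Σ[ splits w ] (f ∘ insert (suc k)))
    ≡⟨ Σ-cong-All (All.map (λ {w} w↭ → Σ-cong-All (All.map (λ {p} → each w↭ {p}) (splits-++ w))) (perms-↭ (D k))) ⟩
  _ ∎
  where
  open ≡-Reasoning
  f : List ℕ → ℕ
  f w = δ (tl w) 0 * δ 1 (h w m)
  each : ∀ {w} → w ↭ D k → ∀ {p} → proj₁ p ++ proj₂ p ≡ w →
    f (insert (suc k) p) ≡ conv (δ 1 ∘ h (proj₁ p) ∘ suc) (δh⁺ (proj₂ p)) m
  -- With nothing after it, the letter `suc k` would belong to the tail, which would then be longer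
  -- than `m`.
  each w↭ {a , []} refl = begin
    δ (tl (a ∷ʳ suc k)) 0 * δ 1 (h (a ∷ʳ suc k) m)
      ≡⟨ cong (λ t → δ t 0 * δ 1 (h (a ∷ʳ suc k) m))
           (tl-∷ʳ {a = a} (trans (cong length (sym (++-identityʳ a))) (D-perm-length w↭))) ⟩
    0
      ≡⟨ conv-zero (δ 1 ∘ h a ∘ suc) m ⟨
    conv (δ 1 ∘ h a ∘ suc) (λ _ → 0) m ∎
  each w↭ {a , b₀ ∷ b} refl = begin
    δ (tl (a ++ suc k ∷ b₀ ∷ b)) 0 * δ 1 (h (a ++ suc k ∷ b₀ ∷ b) m)
      ≡⟨ cong (λ t → δ t 0 * δ 1 (h (a ++ suc k ∷ b₀ ∷ b) m))
           (tl-0 {a = a} (D-perm-length w↭) (All.++⁻ʳ a (D-perm-< w↭))) ⟩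
    1 * δ 1 (h (a ++ suc k ∷ b₀ ∷ b) m)
      ≡⟨ *-identityˡ _ ⟩
    δ 1 (h (a ++ suc k ∷ b₀ ∷ b) m)
      ≡⟨ δ-h (All.++⁻ˡ a (D-perm-< w↭)) (All.++⁻ʳ a (D-perm-< w↭)) m ⟩
    conv (δ 1 ∘ h a ∘ suc) (δ 1 ∘ h (b₀ ∷ b)) m ∎

E-recurrence : ∀ m k → E m (m + suc k) ≡
  Σ[ upTo m ] (λ j → Σ[ upTo k ] (λ a → (k C a) * (N (suc j) a * N (m ∸ suc j) (k ∸ a))))
E-recurrence m k = begin
  E m (m + suc k)
    ≡⟨ E-splits m k ⟩
  Σ[ perms (D k) ] (λ w → Σ[ splits w ] (λ (a , b) → conv (δ 1 ∘ h a ∘ suc) (δh⁺ b) m))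
    ≡⟨ Σ-perms-splits (D k) _ ⟩
  Σ[ parts (D k) ] (λ (y , z) → Σ[ perms y ] (λ a → Σ[ perms z ] (λ b → conv (δ 1 ∘ h a ∘ suc) (δh⁺ b) m)))
    ≡⟨ Σ-cong-All (All.map (λ (dy , dz) → each dy dz) (parts-AllPairs (D-decreasing k))) ⟩
  Σ[ parts (D k) ] (λ (y , z) → Σ[ upTo m ] (λ j → N (suc j) (length y) * N⁺ (m ∸ suc j) (length z)))
    ≡⟨ Σ-swap (λ (y , z) j → N (suc j) (length y) * N⁺ (m ∸ suc j) (length z)) (parts (D k)) (upTo m) ⟩
  Σ[ upTo m ] (λ j → Σ[ parts (D k) ] (λ (y , z) → N (suc j) (length y) * N⁺ (m ∸ suc j) (length z)))
    ≡⟨ Σ-cong by-size (upTo m) ⟩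
  _ ∎
  where
  open ≡-Reasoning
  each : ∀ {y z} → AllPairs _>_ y → AllPairs _>_ z →
    Σ[ perms y ] (λ a → Σ[ perms z ] (λ b → conv (δ 1 ∘ h a ∘ suc) (δh⁺ b) m)) ≡
    Σ[ upTo m ] (λ j → N (suc j) (length y) * N⁺ (m ∸ suc j) (length z))
  each {y} {z} dy dz = begin
    Σ[ perms y ] (λ a → Σ[ perms z ] (λ b → conv (δ 1 ∘ h a ∘ suc) (δh⁺ b) m))
      ≡⟨ conv-Σ (λ a → δ 1 ∘ h a ∘ suc) δh⁺ (perms y) (perms z) m ⟩
    conv (λ j → Σ[ perms y ] (λ a → δ 1 (h a (suc j)))) (λ j → Σ[ perms z ] (λ b → δh⁺ b j)) m
      ≡⟨ conv-upTo _ _ m ⟩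
    Σ[ upTo m ] (λ j → Σ[ perms y ] (λ a → δ 1 (h a (suc j))) * Σ[ perms z ] (λ b → δh⁺ b (m ∸ suc j)))
      ≡⟨ Σ-cong (λ j → cong₂ _*_ (Σ-perms-δ-h dy (suc j)) (Σ-perms-δh⁺ dz (m ∸ suc j))) (upTo m) ⟩
    _ ∎
  by-size : ∀ j → Σ[ parts (D k) ] (λ (y , z) → N (suc j) (length y) * N⁺ (m ∸ suc j) (length z)) ≡
    Σ[ upTo k ] (λ a → (k C a) * (N (suc j) a * N (m ∸ suc j) (k ∸ a)))
  by-size j = begin
    Σ[ parts (D k) ] (λ (y , z) → N (suc j) (length y) * N⁺ (m ∸ suc j) (length z))
      ≡⟨ Σ-parts-length (λ a b → N (suc j) a * N⁺ (m ∸ suc j) b) (D k) ⟩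
    Σ[ upTo (suc (length (D k))) ] (λ a → (length (D k) C a) * (N (suc j) a * N⁺ (m ∸ suc j) (length (D k) ∸ a)))
      ≡⟨ cong (λ l → Σ[ upTo (suc l) ] (λ a → (l C a) * (N (suc j) a * N⁺ (m ∸ suc j) (l ∸ a)))) (length-D k) ⟩
    Σ[ upTo (suc k) ] term⁺
      ≡⟨ Σ-upTo-last term⁺ k ⟩
    Σ[ upTo k ] term⁺ + term⁺ k
      -- The term `a = k` gives all letters to `A` and none to `B`. Its vanishing is what ends the
      -- sum at `a < k`.
      ≡⟨ cong (Σ[ upTo k ] term⁺ +_) last-zero ⟩
    Σ[ upTo k ] term⁺ + 0
      ≡⟨ +-identityʳ (Σ[ upTo k ] term⁺) ⟩
    Σ[ upTo k ] term⁺
      ≡⟨ Σ-applyUpTo-cong k (λ {a} a<k → cong (λ t → (k C a) * (N (suc j) a * t)) (N⁺-N (m ∸ suc j) (m<n⇒0<n∸m a<k))) ⟩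
    _ ∎
    where
    term⁺ : ℕ → ℕ
    term⁺ a = (k C a) * (N (suc j) a * N⁺ (m ∸ suc j) (k ∸ a))
    last-zero : term⁺ k ≡ 0
    last-zero = trans
      (cong (λ t → (k C k) * (N (suc j) k * N⁺ (m ∸ suc j) t)) (n∸n≡0 k))
      (trans (cong ((k C k) *_) (*-zeroʳ (N (suc j) k))) (*-zeroʳ (k C k)))

-- `c n 0` is the number of preimages of the identity, that is, of all binary plane trees with `n`
-- nodes.
c-≥2 : ∀ n → 2 ≤ c (2 + n) 0
c-≥2 = doubling-≥2 (λ j → c j 1) (c-doubling 0) ≤-refl

E-diagonal : ∀ n → 2 ≤ n → E n n ≡ 0
E-diagonal (suc zero) (s≤s ())
E-diagonal n@(suc (suc k)) _ = begin
  E n n              ≡⟨ cong (λ l → E l l) (+-identityʳ n) ⟨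
  E (n + 0) (n + 0)  ≡⟨ E-tail n 0 0 ⟩
  1 * δ 1 (h [] n) + 0
    ≡⟨ cong (λ t → 1 * t + 0) (δ-≢ (<⇒≢ (≤-trans (c-≥2 k) (m≤m+n (c n 0) 0)))) ⟩
  0                  ∎
  where open ≡-Reasoning

theorem6p4 : (∀ (m n : ℕ) → m < n →
    E m n ≡
    ∑[ j from 1 to m ] ∑[ i from 1 to n ∸ m ∸ 1 ]
    (((n ∸ m ∸ 1) C (i ∸ 1)) * E≥ j (i + j ∸ 1) * E≥ (m ∸ j) (n ∸ j ∸ i)))
    × E 1 1 ≡ 1
    × (∀ (n : ℕ) → 2 ≤ n → E n n ≡ 0)
theorem6p4 = recurrence , refl , E-diagonal
  where
  open ≡-Reasoning
  recurrence : ∀ m n → m < n →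
    E m n ≡
    ∑[ j from 1 to m ] ∑[ i from 1 to n ∸ m ∸ 1 ]
    (((n ∸ m ∸ 1) C (i ∸ 1)) * E≥ j (i + j ∸ 1) * E≥ (m ∸ j) (n ∸ j ∸ i))
  -- `k` is `n - m - 1`, the number of letters below the largest letter outside a tail of length
  -- `m`.
  recurrence m n m<n with m≤n⇒∃[o]m+o≡n m<n
  ... | k , refl = begin
    E m (suc m + k)
      ≡⟨ cong (E m) (+-suc m k) ⟨
    E m (m + suc k)
      ≡⟨ E-recurrence m k ⟩
    Σ[ upTo m ] (λ j → Σ[ upTo k ] (λ a → (k C a) * (N (suc j) a * N (m ∸ suc j) (k ∸ a))))
      -- Both sums now start at 1 instead of 0, so that `i` is one more than the number `a` of
      -- letters in `A`.
      ≡⟨ Σ-applyUpTo-cong {f = id} {g = suc} m (λ {j} j<m → Σ-applyUpTo-cong {f = id} {g = suc} k (λ a<k → summand j<m a<k)) ⟩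
    ∑ 1 m (λ j → ∑ 1 k (λ i → (k C (i ∸ 1)) * E≥ j (i + j ∸ 1) * E≥ (m ∸ j) (suc m + k ∸ j ∸ i)))
      ≡⟨ cong (λ k′ → ∑ 1 m (λ j → ∑ 1 k′ (λ i → (k′ C (i ∸ 1)) * E≥ j (i + j ∸ 1) * E≥ (m ∸ j) (suc m + k ∸ j ∸ i)))) size ⟨
    _ ∎
    where
    size : suc m + k ∸ m ∸ 1 ≡ k
    size = cong (_∸ 1) (trans (cong (_∸ m) (sym (+-suc m k))) (m+n∸m≡n m (suc k)))
    split-size : ∀ {j a} → j < m → a < k → suc m + k ∸ suc j ∸ suc a ≡ (m ∸ suc j) + (k ∸ a)
    split-size {j} {a} j<m a<k = begin
      suc m + k ∸ suc j ∸ suc a      ≡⟨ cong (λ t → t ∸ suc j ∸ suc a) (+-suc m k) ⟨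
      m + suc k ∸ suc j ∸ suc a      ≡⟨ cong (_∸ suc a) (+-∸-comm (suc k) j<m) ⟩
      (m ∸ suc j) + suc k ∸ suc a    ≡⟨ +-∸-assoc (m ∸ suc j) (s≤s (<⇒≤ a<k)) ⟩
      (m ∸ suc j) + (k ∸ a)          ∎
    summand : ∀ {j a} → j < m → a < k →
      (k C a) * (N (suc j) a * N (m ∸ suc j) (k ∸ a)) ≡
      (k C a) * E≥ (suc j) (a + suc j) * E≥ (m ∸ suc j) (suc m + k ∸ suc j ∸ suc a)
    summand {j} {a} j<m a<k = begin
      (k C a) * (N (suc j) a * N (m ∸ suc j) (k ∸ a))
        ≡⟨ *-assoc (k C a) (N (suc j) a) (N (m ∸ suc j) (k ∸ a)) ⟨
      (k C a) * N (suc j) a * N (m ∸ suc j) (k ∸ a)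
        ≡⟨ cong₂ (λ s t → (k C a) * s * t)
             (trans (cong (E≥ (suc j)) (+-comm a (suc j))) (E≥-N (suc j) a))
             (trans (cong (E≥ (m ∸ suc j)) (split-size j<m a<k)) (E≥-N (m ∸ suc j) (k ∸ a))) ⟨
      (k C a) * E≥ (suc j) (a + suc j) * E≥ (m ∸ suc j) (suc m + k ∸ suc j ∸ suc a) ∎
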